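{- For every integer $n\ge 2$, the dimension of the best--worst choice polytope $\mathbf{BW}_n$ on $n$ alternatives is $$\dim \mathbf{BW}_n = n(n-3)2^{n-2}+\binom{n}{2}-\binom{n}{3}+n .$$
   Context: Let $[n]=\{1,\dots,n\}$ and let $\Pi_n$ be the set of all rankings (total orders) of $[n]$, written as words $\pi=(\pi_1,\dots,\pi_n)$ in which every element of $[n]$ occurs exactly once; $\pi_1$ is the best and $\pi_n$ the worst element. For $B\subseteq[n]$, the restriction $\pi|_B$ is the ranking of $B$ induced by $\pi$; its first entry is the best element of $B$ under $\pi$ and its last entry is the worst element of $B$ under $\pi$. Let $\Theta_n=\{(a,b,B): B\subseteq[n],\ |B|\ge 2,\ a,b\in B,\ a\ne b\}$. For $\pi\in\Pi_n$ let $v_\pi\in\mathbb{R}^{\Theta_n}$ be the 0/1 vector whose $(a,b,B)$-coordinate is $1$ if $a$ is the best element of $B$ under $\pi$ and $b$ is the worst element of $B$ under $\pi$, and $0$ otherwise. The best--worst choice polytope is $\mathbf{BW}_n=\operatorname{conv}\{v_\pi:\pi\in\Pi_n\}\subseteq\mathbb{R}^{\Theta_n}$. The dimension of a polytope is the dimension of its affine hull. (For $n=2$, $\binom{n}{3}=0$.) -}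

module Defs where

open import Algebra.Apartness.Bundles using (HeytingField)
open import Algebra.Bundles using (CommutativeRing)
import Algebra.Definitions.RawMonoid as RawMonoidOps
import Algebra.Properties.Semiring.Sum as SemiringSum
open import Data.Bool.Base using (if_then_else_)
open import Data.Fin.Base using (Fin)
open import Data.Fin.Permutation using (Permutation′; _⟨$⟩ʳ_)
open import Data.Fin.Properties using (_≟_)
open import Data.Fin.Subset using (Subset; _∈_; ∣_∣)
open import Data.Fin.Subset.Properties using (_∈?_)
open import Data.List.Base using (List; filter; head; last; tabulate)
open import Data.Maybe.Base using (Maybe; just)
open import Data.Maybe.Properties using (≡-dec)
open import Data.Nat.Base as ℕ using (ℕ)
open import Data.Product.Base using (_×_; ∃-syntax)
open import Data.Sum.Base using (_⊎_)
open import Data.Vec.Functional using (Vector)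
open import Level using (Level; _⊔_; suc)
open import Relation.Binary.Core using (Rel)
open import Relation.Binary.PropositionalEquality.Core using (_≡_; _≢_)
open import Relation.Binary.Structures using (IsStrictPartialOrder)
open import Relation.Nullary.Decidable.Core using (Dec; does; _×-dec_)
open import Relation.Nullary.Negation.Core using (¬_)
open import Relation.Unary using (Pred)

private
  variable
    c ℓ₁ ℓ₂ ℓ₃ ℓ : Level
    n : ℕ

-- The standard library has no real numbers, so they are axiomatised as a
-- Cauchy-complete Archimedean ordered field.  Classically this determines ℝ
-- up to isomorphism; constructively, Bishop's reals satisfy these axioms.
record Reals c ℓ₁ ℓ₂ ℓ₃ : Set (suc (c ⊔ ℓ₁ ⊔ ℓ₂ ⊔ ℓ₃)) where
  infix 4 _<_ _≤_
  field
    heytingField : HeytingField c ℓ₁ ℓ₂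

  open HeytingField heytingField public

  ring : CommutativeRing c ℓ₁
  ring = record { isCommutativeRing = isCommutativeRing }

  open RawMonoidOps (CommutativeRing.+-rawMonoid ring) public
    using () renaming (_×_ to _·_)

  field
    _<_                  : Rel Carrier ℓ₃
    isStrictPartialOrder : IsStrictPartialOrder _≈_ _<_
    #⇒<⊎>                : ∀ {x y} → x # y → x < y ⊎ y < x
    <⇒#                  : ∀ {x y} → x < y → x # y
    +-monoˡ-<            : ∀ z {x y} → x < y → x + z < y + z
    *-positive           : ∀ {x y} → 0# < x → 0# < y → 0# < x * y
    archimedean          : ∀ x → ∃[ k ] x < k · 1#

  _≤_ : Rel Carrier ℓ₃
  x ≤ y = ¬ (y < x)

  -- As m and k are interchangeable, this bounds the absolute difference.
  Cauchy : (ℕ → Carrier) → Set (c ⊔ ℓ₃)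
  Cauchy s = ∀ ε → 0# < ε →
    ∃[ N ] (∀ m k → N ℕ.≤ m → N ℕ.≤ k → s m < s k + ε)

  _⟶_ : (ℕ → Carrier) → Carrier → Set (c ⊔ ℓ₃)
  s ⟶ x = ∀ ε → 0# < ε →
    ∃[ N ] (∀ m → N ℕ.≤ m → (s m < x + ε) × (x < s m + ε))

  field
    complete : ∀ s → Cauchy s → ∃[ x ] s ⟶ x

module _ (ℝ : Reals c ℓ₁ ℓ₂ ℓ₃) {i} (I : Set i) where
  open Reals ℝ
  open SemiringSum (CommutativeRing.semiring ring) using (sum)

  -- The space ℝ^I, with pointwise equality.
  Point : Set (c ⊔ i)
  Point = I → Carrier

  _≋_ : Rel Point (ℓ₁ ⊔ i)
  x ≋ y = ∀ t → x t ≈ y t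

  lincomb : ∀ {k} → Vector Carrier k → Vector Point k → Point
  lincomb w p t = sum (λ j → w j * p j t)

  conv : Pred Point ℓ → Pred Point (c ⊔ ℓ₁ ⊔ ℓ₃ ⊔ i ⊔ ℓ)
  conv S x = ∃[ k ] ∃[ w ] ∃[ p ]
    (∀ (j : Fin k) → S (p j)) × (∀ j → 0# ≤ w j) × (sum w ≈ 1#) ×
    (x ≋ lincomb w p)

  aff : Pred Point ℓ → Pred Point (c ⊔ ℓ₁ ⊔ i ⊔ ℓ)
  aff S x = ∃[ k ] ∃[ w ] ∃[ p ]
    (∀ (j : Fin k) → S (p j)) × (sum w ≈ 1#) × (x ≋ lincomb w p)

  direction : Pred Point ℓ → Pred Point (c ⊔ ℓ₁ ⊔ i ⊔ ℓ)
  direction A u = ∃[ x ] ∃[ y ] A x × A y × (u ≋ λ t → x t - y t)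

  LinearlyIndependent : ∀ {k} → Vector Point k → Set (c ⊔ ℓ₁ ⊔ i)
  LinearlyIndependent e =
    ∀ w → lincomb w e ≋ (λ _ → 0#) → ∀ j → w j ≈ 0#

  record IsBasis (W : Pred Point ℓ) {k} (e : Vector Point k)
                 : Set (c ⊔ ℓ₁ ⊔ i ⊔ ℓ) where
    field
      members     : ∀ j → W (e j)
      independent : LinearlyIndependent e
      spanning    : ∀ u → W u → ∃[ w ] u ≋ lincomb w e

  -- "dim P = d": the dimension of a nonempty affine space is that of its
  -- direction space.
  HasDimension : Pred Point ℓ → ℕ → Set (c ⊔ ℓ₁ ⊔ i ⊔ ℓ)
  HasDimension P d =
    (∃[ x ] aff P x) ×
    (∃[ e ] IsBasis (direction (aff P)) {d} e)

-- π ⟨$⟩ʳ j is the entry of the word π at position j, position zero being the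
-- best; alternatives are 0, …, n - 1.
Ranking : ℕ → Set
Ranking n = Permutation′ n

infixl 6 _↾_
_↾_ : Ranking n → Subset n → List (Fin n)
π ↾ B = filter (_∈? B) (tabulate (π ⟨$⟩ʳ_))

Best Worst : Ranking n → Subset n → Fin n → Set
Best  π B a = head (π ↾ B) ≡ just a
Worst π B b = last (π ↾ B) ≡ just b

-- The side conditions are irrelevant, so that an element of Θ n is determined
-- by a, b and B alone.
record Θ (n : ℕ) : Set where
  field
    a b    : Fin n
    B      : Subset n
    .2≤∣B∣ : 2 ℕ.≤ ∣ B ∣
    .a∈B   : a ∈ B
    .b∈B   : b ∈ B
    .a≢b   : a ≢ b

bestWorst? : (π : Ranking n) (θ : Θ n) →
             Dec (Best π (Θ.B θ) (Θ.a θ) × Worst π (Θ.B θ) (Θ.b θ))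
bestWorst? π θ = ≡-dec _≟_ (head (π ↾ B)) (just a)
           ×-dec ≡-dec _≟_ (last (π ↾ B)) (just b)
  where open Θ θ

module _ (ℝ : Reals c ℓ₁ ℓ₂ ℓ₃) where
  open Reals ℝ

  vertex : Ranking n → Point ℝ (Θ n)
  vertex π θ = if does (bestWorst? π θ) then 1# else 0#

  BW : ∀ n → Pred (Point ℝ (Θ n)) (c ⊔ ℓ₁ ⊔ ℓ₃)
  BW n = conv ℝ (Θ n) (λ x → ∃[ π ] _≋_ ℝ (Θ n) x (vertex π))

{-# OPTIONS --safe #-}
{- Extend π ↦ v_π linearly to words.  Restricting a word to C sets the letters
   outside C to 1, and a commutator one of whose letters is set to 1 vanishes.
   Hence a product of commutators in exactly the letters of B, preceded by the
   remaining letters, vanishes at all (a, b, C) with B ⊈ C.  With k = |B| and Z a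
   nested commutator ending in [b, d], the coordinates (·, ·, B) of [a, c] Z form
   the matrix (e_a − e_c) ⊗ (e_d − e_b), and those of [a, Z] the matrix
   e_a ⊗ (e_d − e_b) − (−1)^k (e_d − e_b) ⊗ e_a.

   Conversely, let u lie in the direction space and vanish at all C ⊊ B.  Moving
   the elements of B one at a time from below a to above a shows that row a of the
   B-matrix of u has the same sum, up to sign, as its column a; the sum of all
   entries is 0; and for B = {a, b, c} the event that a beats b gives
   u(a,b,B) + u(a,c,B) + u(c,b,B) = u(a,b,{a,b}) = 0.  These relations leave
   k (k − 2) free entries for k ≥ 4, and 1 and 2 for k = 2 and 3, and at these
   entries the matrices above (and [b, d] itself for k = 2) form a triangular
   system.  Taking the subsets B in an order compatible with inclusion makes the
   whole system triangular, so the dimension is the sum of these numbers. -}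

module Submission where

open import Defs
open import Algebra.Bundles using (CommutativeRing)
import Algebra.Properties.CommutativeSemigroup as CommutativeSemigroupProperties
import Algebra.Properties.Ring as RingProperties
import Algebra.Properties.Semiring.Sum as SemiringSum
open import Data.Bool.Base using (Bool; true; false; _∧_; if_then_else_)
open import Data.Fin.Base as Fin
  using (Fin; zero; suc; cast; punchIn; punchOut; remQuot; combine)
open import Data.Fin.Patterns using (0F; 1F; 2F; 3F)
open import Data.Fin.Permutation as Permutation
  using (_⟨$⟩ʳ_; _⟨$⟩ˡ_; inverseˡ; inverseʳ; cast-id; _∘ₚ_)
open import Data.Fin.Properties
  using (_≟_; _<?_; <-trans; <-asym; <-cmp; any?; 0≢1+n; injective⇒≤; cast-is-id;
         suc-injective; punchInᵢ≢i; punchIn-injective; punchIn-punchOut; combine-remQuot;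
         remQuot-combine)
open import Data.Fin.Subset
  using (Subset; inside; outside; _∈_; _∉_; _⊆_; _⊂_; _∪_; ⁅_⁆; ∁; ∣_∣)
open import Data.Fin.Subset.Induction using (⊂-wellFounded)
open import Data.Fin.Subset.Properties
  using (_∈?_; drop-there; drop-∷-⊆; x∈∁p⇒x∉p; x∈p∪q⁻; x∈p∪q⁺; x∈⁅x⁆; x∈⁅y⁆⇒x≡y; ⊆-antisym)
open import Data.Integer.Base as ℤ using (ℤ; 0ℤ; 1ℤ; -1ℤ)
import Data.Integer.Properties as ℤ
open import Data.Integer.Tactic.RingSolver using (solve-∀)
open import Data.List.Base as List
  using (List; []; _∷_; _++_; [_]; filter; head; last; length; lookup; tabulate; allFin;
         map; concat)
open import Data.List.Membership.Propositional using (find) renaming (_∈_ to _∈ₗ_)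
open import Data.List.Membership.Propositional.Properties
  using (∈-map⁺; ∈-∃++; ∈-lookup; ∈-filter⁺; ∈-filter⁻; ∈-tabulate⁺; ∈-++⁺ˡ; ∈-++⁺ʳ)
import Data.List.Properties as List
import Data.List.Relation.Binary.Permutation.Homogeneous as Homogeneous
open import Data.List.Relation.Binary.Permutation.Propositional
  using (_↭_; prep; swap; ↭-refl; ↭-sym; ↭-trans; ↭-reflexive; ↭⇒↭ₛ)
open import Data.List.Relation.Binary.Permutation.Propositional.Properties
  using (All-resp-↭; Any-resp-↭; ∈-resp-↭; ↭-length; map⁺; ++⁺ˡ; ++-comm; shift)
open import Data.List.Relation.Binary.Permutation.Setoid.Properties using (onIndices-lookup)
open import Data.List.Relation.Unary.All as All using (All; []; _∷_)
import Data.List.Relation.Unary.All.Properties as All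
open import Data.List.Relation.Unary.AllPairs as AllPairs using (AllPairs; []; _∷_)
import Data.List.Relation.Unary.AllPairs.Properties as AllPairs
open import Data.List.Relation.Unary.Any as Any using (Any; here; there)
open import Data.List.Relation.Unary.Any.Properties using (lookup-index)
open import Data.List.Relation.Unary.Unique.Propositional using (Unique)
import Data.List.Relation.Unary.Unique.Propositional.Properties as Unique
open import Data.Maybe.Base using (just)
open import Data.Maybe.Properties using (≡-dec; just-injective)
open import Data.Nat.Base as ℕ using (ℕ; zero; suc; pred; _^_; s≤s; z≤n)
import Data.Nat.Combinatorics as ℕ
import Data.Nat.ListAction as ListAction
open import Data.Nat.ListAction.Properties using (sum-++)
import Data.Nat.Properties as ℕ
import Data.Nat.Tactic.RingSolver as ℕ-Solver
open import Data.Product.Base using (_×_; _,_; ∃-syntax; proj₁; proj₂; uncurry)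
open import Data.Sum.Base as Sum using (_⊎_; inj₁; inj₂; [_,_]′)
open import Data.Unit.Base using (tt)
import Data.Unit.Polymorphic.Base as Polymorphic
import Data.Vec.Base as Vec
import Data.Vec.Functional as Vector
open import Function.Base using (_∘_; id; case_of_)
open import Induction.WellFounded using (Acc; acc)
open import Level using (Level; 0ℓ; _⊔_) renaming (suc to lsuc)
open import Relation.Binary.Definitions using (tri<; tri≈; tri>)
open import Relation.Binary.PropositionalEquality as ≡
  using (_≡_; _≢_; refl; sym; trans; cong; cong₂; subst; subst₂)
import Relation.Binary.Reasoning.Setoid as SetoidReasoning
open import Relation.Binary.Structures using (IsStrictPartialOrder)
open import Relation.Nullary.Decidable
  using (Dec; does; yes; no; _×-dec_; _⊎-dec_; ¬?; dec-true; dec-false; recompute)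
open import Relation.Nullary.Negation using (¬_; contradiction)
open import Relation.Unary using (Pred; Decidable)

private
  variable
    n : ℕ

-- Words and subsets

word : Ranking n → List (Fin n)
word π = tabulate (π ⟨$⟩ʳ_)

bestIs worstIs : Fin n → List (Fin n) → Bool
bestIs  a w = does (≡-dec _≟_ (head w) (just a))
worstIs b w = does (≡-dec _≟_ (last w) (just b))

bw : List (Fin n) → Fin n → Fin n → Subset n → Bool
bw w a b B = bestIs a (filter (_∈? B) w) ∧ worstIs b (filter (_∈? B) w)

elems : Subset n → List (Fin n)
elems Vec.[] = []
elems (inside Vec.∷ B) = zero ∷ List.map suc (elems B)
elems (outside Vec.∷ B) = List.map suc (elems B)

length-elems : (B : Subset n) → length (elems B) ≡ ∣ B ∣
length-elems Vec.[] = refl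
length-elems (inside Vec.∷ B) = cong suc (trans (List.length-map suc (elems B)) (length-elems B))
length-elems (outside Vec.∷ B) = trans (List.length-map suc (elems B)) (length-elems B)

∈-elems : {B : Subset n} {x : Fin n} → x ∈ B → x ∈ₗ elems B
∈-elems {B = inside Vec.∷ B} {zero} x∈B = here refl
∈-elems {B = inside Vec.∷ B} {suc x} x∈B = there (∈-map⁺ suc (∈-elems (drop-there x∈B)))
∈-elems {B = outside Vec.∷ B} {suc x} x∈B = ∈-map⁺ suc (∈-elems (drop-there x∈B))

elems-⊆ : (B : Subset n) → All (_∈ B) (elems B)
elems-⊆ Vec.[] = []
elems-⊆ (inside Vec.∷ B) = Vec.here ∷ All.map⁺ (All.map Vec.there (elems-⊆ B))
elems-⊆ (outside Vec.∷ B) = All.map⁺ (All.map Vec.there (elems-⊆ B))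

elems-unique : (B : Subset n) → Unique (elems B)
elems-unique Vec.[] = []
elems-unique (inside Vec.∷ B) =
  All.map⁺ (All.universal (λ _ ()) (elems B)) ∷ Unique.map⁺ suc-injective (elems-unique B)
elems-unique (outside Vec.∷ B) = Unique.map⁺ suc-injective (elems-unique B)

elems-∁-↭ : (B : Subset n) → elems (∁ B) ++ elems B ↭ allFin n
elems-∁-↭ Vec.[] = ↭-refl
elems-∁-↭ {suc n} (inside Vec.∷ B) =
    ↭-trans (shift zero (List.map suc (elems (∁ B))) (List.map suc (elems B)))
  (prep zero (↭-trans (↭-reflexive (sym (List.map-++ suc (elems (∁ B)) (elems B))))
     (↭-trans (map⁺ suc (elems-∁-↭ B)) (↭-reflexive (List.map-tabulate id suc)))))
elems-∁-↭ {suc n} (outside Vec.∷ B) =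
  (prep zero (↭-trans (↭-reflexive (sym (List.map-++ suc (elems (∁ B)) (elems B))))
     (↭-trans (map⁺ suc (elems-∁-↭ B)) (↭-reflexive (List.map-tabulate id suc)))))

tabulate-lookup-cast : {A : Set} (w : List A) (e : n ≡ length w) →
  tabulate (λ j → lookup w (cast e j)) ≡ w
tabulate-lookup-cast w refl =
  trans (List.tabulate-cong (λ j → cong (lookup w) (cast-is-id refl j))) (List.tabulate-lookup w)

lookup-tabulate : {A : Set} (f : Fin n → A) (e : length (tabulate f) ≡ n)
    (i : Fin (length (tabulate f))) →
  lookup (tabulate f) i ≡ f (cast e i)
lookup-tabulate {suc n} f e zero = refl
lookup-tabulate {suc n} f e (suc i) = lookup-tabulate (f ∘ suc) (cong pred e) i

-- A permutation of lists carries a bijection of positions; the two casts only turn the lengths of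
-- `w` and `allFin n` into `n`.
ranking : (w : List (Fin n)) → w ↭ allFin n → ∃[ π ] word π ≡ w
ranking {n} w p = π , trans (List.tabulate-cong step) (tabulate-lookup-cast w len)
  where
  p′ = ↭⇒↭ₛ p
  σ = Homogeneous.onIndices p′
  len : n ≡ length w
  len = trans (sym (List.length-tabulate {n = n} id)) (sym (↭-length p))
  π = cast-id len ∘ₚ σ ∘ₚ cast-id (List.length-tabulate id)
  step : ∀ j → π ⟨$⟩ʳ j ≡ lookup w (cast len j)
  step j = sym (trans (onIndices-lookup (≡.setoid (Fin n)) p′ (cast len j))
      (lookup-tabulate id (List.length-tabulate id) (σ ⟨$⟩ʳ cast len j)))

-- Brings chosen distinct letters to the front. Removing one letter from `l` keeps the rest of `as`
-- available because they differ from it.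
extract : {A : Set} (as : List A) {l : List A} → Unique as → All (_∈ₗ l) as →
  ∃[ xs ] l ↭ as ++ xs
extract [] [] [] = _ , ↭-refl
extract {A = A} (a ∷ as) (a∉as ∷ u) (a∈l ∷ as∈l) with ys , zs , refl ← ∈-∃++ a∈l =
  let xs , p = extract as u (All.zipWith (λ { (a≢b , b∈l) → drop a≢b b∈l }) (a∉as , as∈l))
  in  xs , ↭-trans (shift a ys zs) (prep a p)
  where
  drop : ∀ {b} → a ≢ b → b ∈ₗ ys ++ a ∷ zs → b ∈ₗ ys ++ zs
  drop a≢b b∈ with ∈-resp-↭ (shift a ys zs) b∈
  ... | here refl = contradiction refl a≢b
  ... | there i = i

lookup-injective : {A : Set} {xs : List A} → Unique xs → ∀ i j → lookup xs i ≡ lookup xs j → i ≡ j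
lookup-injective (x∉ ∷ u) zero zero eq = refl
lookup-injective {xs = _ ∷ xs} (x∉ ∷ u) zero (suc j) eq =
    contradiction eq (All.lookup x∉ (∈-lookup j))
lookup-injective {xs = _ ∷ xs} (x∉ ∷ u) (suc i) zero eq =
    contradiction (sym eq) (All.lookup x∉ (∈-lookup i))
lookup-injective (x∉ ∷ u) (suc i) (suc j) eq = cong suc (lookup-injective u i j eq)

-- Nested commutators

⟦_⟧ : Bool → ℤ
⟦ b ⟧ = if b then 1ℤ else 0ℤ

⟦∧⟧ : ∀ p q → ⟦ p ∧ q ⟧ ≡ ⟦ p ⟧ ℤ.* ⟦ q ⟧
⟦∧⟧ false q = refl
⟦∧⟧ true q = sym (ℤ.*-identityˡ ⟦ q ⟧)

δ : Fin n → Fin n → ℤ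
δ a x = ⟦ does (a ≟ x) ⟧

minus-interchange : ∀ p q r s → (p ℤ.- q) ℤ.- (r ℤ.- s) ≡ (p ℤ.- r) ℤ.- (q ℤ.- s)
minus-interchange = solve-∀

*-factor : ∀ t p q → t ℤ.* p ℤ.- t ℤ.* q ≡ t ℤ.* (p ℤ.- q)
*-factor = solve-∀

module _ {A : Set} where

  -- The value of f, extended linearly, at the nested commutator
  -- [x₁, [x₂, … [c , d]]].
  nest : A → A → List A → (List A → ℤ) → ℤ
  nest c d []       f = f (c ∷ d ∷ []) ℤ.- f (d ∷ c ∷ [])
  nest c d (x ∷ xs) f = nest c d xs λ w → f (x ∷ w) ℤ.- f (w ++ [ x ])

  private
    variable
      c d x : A
      xs w : List A

  innermost : c ∷ d ∷ [] ↭ [] ++ c ∷ d ∷ []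
  innermost = ↭-refl

  innermost′ : d ∷ c ∷ [] ↭ [] ++ c ∷ d ∷ []
  innermost′ = swap _ _ ↭-refl

  cons-↭ : w ↭ xs ++ c ∷ d ∷ [] → x ∷ w ↭ x ∷ xs ++ c ∷ d ∷ []
  cons-↭ = prep _

  snoc-↭ : w ↭ xs ++ c ∷ d ∷ [] → w ++ [ x ] ↭ x ∷ xs ++ c ∷ d ∷ []
  snoc-↭ {w = w} {x = x} p = ↭-trans (++-comm w [ x ]) (prep _ p)

  -- The expansion contains only rearrangements of the letters, so agreement on these is enough.
  -- Later evaluations thereby may use that a word is nonempty, or that it uses up all of a subset.
  nest-cong : ∀ c d xs {f g} → (∀ w → w ↭ xs ++ c ∷ d ∷ [] → f w ≡ g w) →
              nest c d xs f ≡ nest c d xs g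
  nest-cong c d [] f≡g = cong₂ ℤ._-_ (f≡g _ innermost) (f≡g _ innermost′)
  nest-cong c d (x ∷ xs) f≡g =
    nest-cong c d xs λ w p → cong₂ ℤ._-_ (f≡g _ (cons-↭ p)) (f≡g _ (snoc-↭ p))

  nest-minus : ∀ c d xs f g → nest c d xs (λ w → f w ℤ.- g w) ≡ nest c d xs f ℤ.- nest c d xs g
  nest-minus c d [] f g = minus-interchange (f (c ∷ d ∷ [])) (g (c ∷ d ∷ [])) (f (d ∷ c ∷ []))
      (g (d ∷ c ∷ []))
  nest-minus c d (x ∷ xs) f g =
      trans (nest-cong c d xs λ w _ → minus-interchange (f (x ∷ w)) (g (x ∷ w)) (f (w ++ [ x ]))
        (g (w ++ [ x ]))) (nest-minus c d xs _ _)

  nest-* : ∀ t c d xs f → nest c d xs (λ w → t ℤ.* f w) ≡ t ℤ.* nest c d xs f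
  nest-* t c d [] f = *-factor t (f (c ∷ d ∷ [])) (f (d ∷ c ∷ []))
  nest-* t c d (x ∷ xs) f = trans (nest-cong c d xs λ w _ → *-factor t (f (x ∷ w)) (f (w ++ [ x ])))
      (nest-* t c d xs _)

  nest-0 : ∀ c d xs {f} → (∀ w → f w ≡ 0ℤ) → nest c d xs f ≡ 0ℤ
  nest-0 c d [] f≡0 = cong₂ ℤ._-_ (f≡0 _) (f≡0 _)
  nest-0 c d (x ∷ xs) f≡0 = nest-0 c d xs λ w → cong₂ ℤ._-_ (f≡0 _) (f≡0 _)

  -- The coefficients of a commutator add up to 0.
  nest-constant : ∀ c d xs t → nest c d xs (λ _ → t) ≡ 0ℤ
  nest-constant c d [] t = ℤ.+-inverseʳ t
  nest-constant c d (x ∷ xs) t = nest-0 c d xs λ _ → ℤ.+-inverseʳ t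

  nest-nonempty : ∀ c d xs {f g} → (∀ y ys → f (y ∷ ys) ≡ g (y ∷ ys)) →
      nest c d xs f ≡ nest c d xs g
  nest-nonempty c d xs {f} {g} f≡g = nest-cong c d xs agree
    where
    agree : ∀ w → w ↭ xs ++ c ∷ d ∷ [] → f w ≡ g w
    agree [] p with () ← ↭-length (↭-trans p (shift c xs (d ∷ [])))
    agree (y ∷ ys) _ = f≡g y ys

  module _ {P : Pred A 0ℓ} (P? : Decidable P) where

    DependsOnRestriction : (List A → ℤ) → Set
    DependsOnRestriction f = ∀ w w′ → filter P? w ≡ filter P? w′ → f w ≡ f w′

    -- Restriction sets a letter outside `P` to 1. If the outer letter `x` is one, `x w` and `w x`
    -- restrict alike and every difference is 0. Otherwise bracketing with `x` preserves dependence
    -- on the restriction, and the rejected letter lies further inside.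
    nest-vanishes : ∀ c d xs {f} → DependsOnRestriction f →
                    Any (λ x → ¬ P x) (c ∷ d ∷ xs) → nest c d xs f ≡ 0ℤ
    nest-vanishes c d [] {f} dep ¬P = trans
        (cong (ℤ._- f (d ∷ c ∷ [])) (dep (c ∷ d ∷ []) (d ∷ c ∷ []) (commute ¬P)))
        (ℤ.+-inverseʳ (f (d ∷ c ∷ [])))
      where
      commute : Any (λ x → ¬ P x) (c ∷ d ∷ []) → filter P? (c ∷ d ∷ []) ≡ filter P? (d ∷ c ∷ [])
      commute (here ¬Pc) rewrite List.filter-reject P? {x = c} {d ∷ []} ¬Pc | List.filter-++ P?
          (d ∷ []) (c ∷ [])
        | List.filter-reject P? {x = c} {[]} ¬Pc = sym (List.++-identityʳ _)
      commute (there (here ¬Pd)) rewrite List.filter-reject P? {x = d} {c ∷ []} ¬Pd | List.filter-++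
          P? (c ∷ []) (d ∷ [])
        | List.filter-reject P? {x = d} {[]} ¬Pd = List.++-identityʳ _
    nest-vanishes c d (x ∷ xs) {f} dep ¬P with P? x
    ... | no ¬Px = nest-0 c d xs λ w → trans
          (cong (ℤ._- f (w ++ [ x ])) (dep (x ∷ w) (w ++ [ x ])
            (trans (List.filter-reject P? {x = x} {w} ¬Px) (sym (trans (List.filter-++ P? w [ x ])
              (trans (cong (filter P? w ++_) (List.filter-reject P? {x = x} {[]} ¬Px))
                  (List.++-identityʳ _)))))))
          (ℤ.+-inverseʳ (f (w ++ [ x ])))
    ... | yes Px = nest-vanishes c d xs dep′ (skip ¬P)
      where
      skip : Any (λ x → ¬ P x) (c ∷ d ∷ x ∷ xs) → Any (λ x → ¬ P x) (c ∷ d ∷ xs)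
      skip (here p) = here p
      skip (there (here p)) = there (here p)
      skip (there (there (here ¬Px))) = contradiction Px ¬Px
      skip (there (there (there p))) = there (there p)
      dep′ : DependsOnRestriction λ w → f (x ∷ w) ℤ.- f (w ++ [ x ])
      dep′ w w′ eq = cong₂ ℤ._-_
        (dep _ _ (trans (List.filter-accept P? Px)
            (trans (cong (x ∷_) eq) (sym (List.filter-accept P? Px)))))
        (dep _ _ (trans (List.filter-++ P? w [ x ])
            (trans (cong (_++ filter P? [ x ]) eq) (sym (List.filter-++ P? w′ [ x ])))))

first final : Fin n → List (Fin n) → ℤ
first x w = ⟦ bestIs x w ⟧
final y w = ⟦ worstIs y w ⟧

sgn : ℕ → ℤ
sgn zero = 1ℤ
sgn (suc k) = ℤ.- sgn k

last-++ : ∀ {A : Set} (w : List A) x → last (w ++ [ x ]) ≡ just x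
last-++ [] x = refl
last-++ (y ∷ []) x = refl
last-++ (y ∷ z ∷ w) x = last-++ (z ∷ w) x

-- The words `w x` all end in `x` and their coefficients add up to 0, so an outer bracket does not
-- affect the count of last letters. Only the innermost `c d - d c` matters.
nest-final : ∀ (c d : Fin n) xs y → nest c d xs (final y) ≡ δ d y ℤ.- δ c y
nest-final c d [] y = refl
nest-final c d (x ∷ xs) y = trans
  (trans (nest-nonempty c d xs {g = λ w → final y w ℤ.- δ x y} λ a w →
     cong (λ v → final y (a ∷ w) ℤ.- ⟦ does (≡-dec _≟_ v (just y)) ⟧) (last-++ (a ∷ w) x))
   (nest-minus c d xs (final y) (λ _ → δ x y)))
  (trans (cong₂ ℤ._-_ (nest-final c d xs y) (nest-constant c d xs (δ x y))) (ℤ.+-identityʳ _))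

-- Here the words `x w` cancel, and the words `w x`, which keep the first letter of `w`, carry a
-- minus sign: one sign change per outer letter.
nest-first : ∀ (c d : Fin n) xs x → nest c d xs (first x) ≡ sgn (length xs) ℤ.* (δ c x ℤ.- δ d x)
nest-first c d [] x = sym (ℤ.*-identityˡ _)
nest-first c d (a ∷ xs) x = trans
  (trans (nest-nonempty c d xs {g = λ w → δ a x ℤ.- first x w} λ _ _ → refl)
   (nest-minus c d xs (λ _ → δ a x) (first x)))
  (trans (cong₂ ℤ._-_ (nest-constant c d xs (δ a x)) (nest-first c d xs x))
    (lemma (sgn (length xs)) _))
  where
  lemma : ∀ s t → 0ℤ ℤ.- s ℤ.* t ≡ ℤ.- s ℤ.* t
  lemma = solve-∀

-- Integer combinations of vertices

Raw : ℕ → Set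
Raw n = Fin n → Fin n → Subset n → ℤ

indicator : List (Fin n) → Raw n
indicator w a b C = ⟦ bw w a b C ⟧

-- The index is the sum of the coefficients.
data Combination {n} : ℤ → Raw n → Set where
  vertexOf : ∀ π → Combination 1ℤ (indicator (word π))
  minus    : ∀ {r s u v} → Combination r u → Combination s v →
             Combination (r ℤ.- s) (λ a b C → u a b C ℤ.- v a b C)
  respects : ∀ {r s u v} → r ≡ s → (∀ a b C → u a b C ≡ v a b C) →
             Combination r u → Combination s v

indicator-combination : ∀ {w : List (Fin n)} → w ↭ allFin n → Combination 1ℤ (indicator w)
indicator-combination p with π , eq ← ranking _ p =
  respects refl (λ a b C → cong (λ w → indicator w a b C) eq) (vertexOf π)

-- Each bracket subtracts two combinations with equal coefficient sums, so the sum drops to 0 and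
-- stays there.
nest-combination : ∀ c d xs (F : List (Fin n) → Raw n) {r} →
  (∀ w → w ↭ xs ++ c ∷ d ∷ [] → Combination r (F w)) →
  Combination 0ℤ (λ a b C → nest c d xs λ w → F w a b C)
nest-combination c d [] F {r} comb =
  respects (ℤ.+-inverseʳ r) (λ _ _ _ → refl) (minus (comb _ innermost) (comb _ innermost′))
nest-combination c d (x ∷ xs) F comb = nest-combination c d xs
  (λ w a b C → F (x ∷ w) a b C ℤ.- F (w ++ [ x ]) a b C)
  λ w p → minus (comb _ (cons-↭ p)) (comb _ (snoc-↭ p))

indicator-cong : ∀ (w w′ : List (Fin n)) a b C → filter (_∈? C) w ≡ filter (_∈? C) w′ →
          indicator w a b C ≡ indicator w′ a b C
indicator-cong w w′ a b C = cong λ v → ⟦ bestIs a v ∧ worstIs b v ⟧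

filter-++-cong : ∀ (C : Subset n) z w w′ → filter (_∈? C) w ≡ filter (_∈? C) w′ →
                 filter (_∈? C) (z ++ w) ≡ filter (_∈? C) (z ++ w′)
filter-++-cong C z w w′ eq = trans (List.filter-++ (_∈? C) z w)
  (trans (cong (filter (_∈? C) z ++_) eq) (sym (List.filter-++ (_∈? C) z w′)))

-- At most one of the two letters survives, so their order is lost: the factor `a c - c a` restricts
-- to 0.
filter-swap : ∀ {C : Subset n} a c {w} → Any (_∉ C) (a ∷ c ∷ []) →
              filter (_∈? C) (a ∷ c ∷ w) ≡ filter (_∈? C) (c ∷ a ∷ w)
filter-swap {C = C} a c {w} (here a∉C) = trans (List.filter-reject (_∈? C) a∉C) (go (c ∈? C))
  where
  go : Dec (c ∈ C) → filter (_∈? C) (c ∷ w) ≡ filter (_∈? C) (c ∷ a ∷ w)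
  go (yes c∈C) = trans (List.filter-accept (_∈? C) c∈C)
    (sym (trans (List.filter-accept (_∈? C) c∈C) (cong (c ∷_) (List.filter-reject (_∈? C) a∉C))))
  go (no c∉C) = trans (List.filter-reject (_∈? C) c∉C)
    (sym (trans (List.filter-reject (_∈? C) c∉C) (List.filter-reject (_∈? C) a∉C)))
filter-swap a c (there (here c∉C)) = sym (filter-swap c a (here c∉C))

-- Integer matrices realised at the coordinates of one subset

module Realisation (B : Subset n) where

  private
    z = elems (∁ B)

  k : ℕ
  k = length (elems B)

  ι : Fin k → Fin n
  ι = lookup (elems B)

  ι-injective : ∀ {i j} → ι i ≡ ι j → i ≡ j
  ι-injective = lookup-injective (elems-unique B) _ _

  δ-ι : ∀ i j → δ (ι i) (ι j) ≡ δ i j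
  δ-ι i j with i ≟ j
  ... | yes refl rewrite dec-true (ι i ≟ ι i) refl = refl
  ... | no i≢j rewrite dec-false (ι i ≟ ι j) (i≢j ∘ ι-injective) = refl

  -- These matrices supply the diagonal blocks of the triangular system. Coefficient sum 0 makes `u`
  -- a direction, and `vanishes` gives triangularity between different subsets.
  record Realisable (M : Fin k → Fin k → ℤ) : Set where
    field
      u           : Raw n
      combination : Combination 0ℤ u
      vanishes    : ∀ a b C → ¬ B ⊆ C → u a b C ≡ 0ℤ
      agrees      : ∀ i j → u (ι i) (ι j) B ≡ M i j

  open Realisable public

  realisable-cong : ∀ {M M′} → (∀ i j → M i j ≡ M′ i j) → Realisable M → Realisable M′
  realisable-cong eq r = record
    { combination = combination r ; vanishes = vanishes r
    ; agrees = λ i j → trans (agrees r i j) (eq i j) }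

  realisable-minus : ∀ {M M′} → Realisable M → Realisable M′ → Realisable (λ i j → M i j ℤ.- M′ i j)
  realisable-minus r r′ = record
    { combination = minus (combination r) (combination r′)
    ; vanishes = λ a b C B⊈C → cong₂ ℤ._-_ (vanishes r a b C B⊈C) (vanishes r′ a b C B⊈C)
    ; agrees = λ i j → cong₂ ℤ._-_ (agrees r i j) (agrees r′ i j) }

  -- Subtraction is the only operation of `Combination`, so negation is obtained as `(x - x) - x`,
  -- and addition from it.
  realisable-neg : ∀ {M} → Realisable M → Realisable (λ i j → ℤ.- M i j)
  realisable-neg {M} r = realisable-cong (λ i j → lemma (M i j))
      (realisable-minus (realisable-minus r r) r)
    where
    lemma : ∀ x → (x ℤ.- x) ℤ.- x ≡ ℤ.- x
    lemma = solve-∀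

  realisable-+ : ∀ {M M′} → Realisable M → Realisable M′ → Realisable (λ i j → M i j ℤ.+ M′ i j)
  realisable-+ {M} {M′} r r′ =
      realisable-cong (λ i j → cong (λ x → M i j ℤ.+ x) (ℤ.neg-involutive (M′ i j)))
    (realisable-minus r (realisable-neg r′))

  realisable-sgn : ∀ {M} m → Realisable M → Realisable (λ i j → sgn m ℤ.* M i j)
  realisable-sgn zero r = realisable-cong (λ i j → sym (ℤ.*-identityˡ _)) r
  realisable-sgn (suc m) r = realisable-cong (λ i j → ℤ.neg-distribˡ-* (sgn m) _)
      (realisable-neg (realisable-sgn m r))

  missing : ∀ {xs C} → elems B ↭ xs → ¬ B ⊆ C → Any (_∉ C) xs
  missing {C = C} p B⊈C = Any-resp-↭ p (All.¬All⇒Any¬ (_∈? C) (elems B)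
    λ all → B⊈C λ x∈B → All.lookup all (∈-elems x∈B))

  arrangement : ∀ {w} → elems B ↭ w → Combination 1ℤ (indicator (z ++ w))
  arrangement p = indicator-combination (↭-trans (++⁺ˡ z (↭-sym p)) (elems-∁-↭ B))

  -- The prefix `z` lies outside `B`, so the restriction to `B` is `w` itself.
  indicator-B : ∀ {w} → elems B ↭ w → ∀ x y → indicator (z ++ w) x y B ≡ first x w ℤ.* final y w
  indicator-B {w} p x y = trans (cong (λ v → ⟦ bestIs x v ∧ worstIs y v ⟧) restrict)
      (⟦∧⟧ (bestIs x w) (worstIs y w))
    where
    restrict : filter (_∈? B) (z ++ w) ≡ w
    restrict = trans (List.filter-++ (_∈? B) z w) (cong₂ _++_
      (List.filter-none (_∈? B) (All.map x∈∁p⇒x∉p (elems-⊆ (∁ B))))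
      (List.filter-all (_∈? B) (All-resp-↭ p (elems-⊆ B))))

  nested : ∀ c d xs → elems B ↭ c ∷ d ∷ xs →
           (M : Fin k → Fin k → ℤ) →
           (∀ i j → nest c d xs (λ w → first (ι i) w ℤ.* final (ι j) w) ≡ M i j) →
           Realisable M
  nested c d xs p M eq = record
    { combination = nest-combination c d xs (λ w → indicator (z ++ w)) λ w q → arrangement (rest q)
    ; vanishes = λ a b C B⊈C → nest-vanishes (_∈? C) c d xs
        (λ w w′ e → indicator-cong (z ++ w) (z ++ w′) a b C (filter-++-cong C z w w′ e))
            (missing p B⊈C)
    ; agrees = λ i j → trans (nest-cong c d xs λ w q → indicator-B (rest q) (ι i) (ι j)) (eq i j)
    }
    where
    rest : ∀ {w} → w ↭ xs ++ c ∷ d ∷ [] → elems B ↭ w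
    rest q = ↭-trans p (↭-trans (++-comm (c ∷ d ∷ []) xs) (↭-sym q))

  -- The matrix of [a , c] Z, where Z = [x₁, [x₂, … [b , d]]].
  swapped : ∀ a c b d xs → elems B ↭ a ∷ c ∷ b ∷ d ∷ xs →
            Realisable (λ i j → (δ a (ι i) ℤ.- δ c (ι i)) ℤ.* (δ d (ι j) ℤ.- δ b (ι j)))
  swapped a c b d xs p = record
    { combination = nest-combination b d xs F λ w q →
        minus (arrangement (rest q)) (arrangement (rest′ q))
    ; vanishes = λ x y C B⊈C → vanish x y C (missing p B⊈C)
    ; agrees = λ i j → trans (nest-cong b d xs λ w q → value i j w q)
        (trans (nest-* (δ a (ι i) ℤ.- δ c (ι i)) b d xs (final (ι j)))
            (cong ((δ a (ι i) ℤ.- δ c (ι i)) ℤ.*_) (nest-final b d xs (ι j))))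
    }
    where
    F : List (Fin n) → Raw n
    F w x y C = indicator (z ++ a ∷ c ∷ w) x y C ℤ.- indicator (z ++ c ∷ a ∷ w) x y C
    rest : ∀ {w} → w ↭ xs ++ b ∷ d ∷ [] → elems B ↭ a ∷ c ∷ w
    rest q = ↭-trans p (prep a (prep c (↭-trans (++-comm (b ∷ d ∷ []) xs) (↭-sym q))))
    rest′ : ∀ {w} → w ↭ xs ++ b ∷ d ∷ [] → elems B ↭ c ∷ a ∷ w
    rest′ q = ↭-trans (rest q) (swap a c ↭-refl)
    F-0 : ∀ {x y C} → Any (_∉ C) (a ∷ c ∷ []) → ∀ w → F w x y C ≡ 0ℤ
    F-0 {x} {y} {C} m w =
        trans (cong (ℤ._- indicator (z ++ c ∷ a ∷ w) x y C)
          (indicator-cong (z ++ a ∷ c ∷ w) (z ++ c ∷ a ∷ w) x y C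
            (filter-++-cong C z (a ∷ c ∷ w) (c ∷ a ∷ w) (filter-swap a c m))))
      (ℤ.+-inverseʳ (indicator (z ++ c ∷ a ∷ w) x y C))
    vanish : ∀ x y C → Any (_∉ C) (a ∷ c ∷ b ∷ d ∷ xs) → nest b d xs (λ w → F w x y C) ≡ 0ℤ
    vanish x y C (here m) = nest-0 b d xs (F-0 {x} {y} (here m))
    vanish x y C (there (here m)) = nest-0 b d xs (F-0 {x} {y} (there (here m)))
    vanish x y C (there (there m)) = nest-vanishes (_∈? C) b d xs
      (λ w w′ e → cong₂ ℤ._-_ (keep (a ∷ c ∷ []) w w′ e) (keep (c ∷ a ∷ []) w w′ e)) m
      where
      keep : ∀ v w w′ → filter (_∈? C) w ≡ filter (_∈? C) w′ →
             indicator (z ++ v ++ w) x y C ≡ indicator (z ++ v ++ w′) x y C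
      keep v w w′ e = indicator-cong (z ++ v ++ w) (z ++ v ++ w′) x y C
        (filter-++-cong C z (v ++ w) (v ++ w′) (filter-++-cong C v w w′ e))
    -- As `w` is nonempty, `a c w` and `c a w` end like `w`; they differ only in the first letter,
    -- and `final` factors out.
    value : ∀ i j w → w ↭ xs ++ b ∷ d ∷ [] → F w (ι i) (ι j) B ≡
            (δ a (ι i) ℤ.- δ c (ι i)) ℤ.* final (ι j) w
    value i j [] q with () ← ↭-length (↭-trans q (shift b xs (d ∷ [])))
    value i j w@(_ ∷ _) q =
        trans (cong₂ ℤ._-_ (indicator-B (rest q) (ι i) (ι j)) (indicator-B (rest′ q) (ι i) (ι j)))
      (lemma (δ a (ι i)) (δ c (ι i)) (final (ι j) w))
      where
      lemma : ∀ p q t → p ℤ.* t ℤ.- q ℤ.* t ≡ (p ℤ.- q) ℤ.* t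
      lemma = solve-∀

  complement : (is : List (Fin k)) → Unique is → ∃[ xs ] elems B ↭ List.map ι is ++ xs
  complement is u = extract (List.map ι is) (Unique.map⁺ ι-injective u)
    (All.map⁺ (All.universal (λ i → ∈-lookup i) is))

  typeI : ∀ a c b d → Unique (a ∷ c ∷ b ∷ d ∷ []) →
          Realisable (λ i j → (δ a i ℤ.- δ c i) ℤ.* (δ d j ℤ.- δ b j))
  typeI a c b d u = let xs , p = complement _ u in
    realisable-cong
        (λ i j → cong₂ ℤ._*_ (cong₂ ℤ._-_ (δ-ι a i) (δ-ι c i)) (cong₂ ℤ._-_ (δ-ι d j) (δ-ι b j)))
      (swapped _ _ _ _ xs p)

  -- The matrix of [a , Z], where Z = [x₁, [x₂, … [c , d]]].
  typeII : ∀ a c d → Unique (c ∷ d ∷ a ∷ []) →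
           Realisable (λ i j →
               δ a i ℤ.* (δ d j ℤ.- δ c j) ℤ.- sgn k ℤ.* ((δ d i ℤ.- δ c i) ℤ.* δ a j))
  typeII a c d u = let xs , p = complement _ u in nested (ι c) (ι d) (ι a ∷ xs) p _ (eq xs p)
    where
    -- As `k` is `3 + length xs`, three negations of `sgn (length xs)` make up `sgn k`.
    lemma : ∀ p q r t s →
        p ℤ.* q ℤ.- s ℤ.* r ℤ.* t ≡ p ℤ.* q ℤ.- ℤ.- (ℤ.- (ℤ.- s)) ℤ.* (ℤ.- r ℤ.* t)
    lemma = solve-∀
    neg : ∀ c d → ℤ.- (c ℤ.- d) ≡ d ℤ.- c
    neg = solve-∀
    eq : ∀ xs → elems B ↭ ι c ∷ ι d ∷ ι a ∷ xs → ∀ i j →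
         nest (ι c) (ι d) (ι a ∷ xs) (λ w → first (ι i) w ℤ.* final (ι j) w) ≡
         δ a i ℤ.* (δ d j ℤ.- δ c j) ℤ.- sgn k ℤ.* ((δ d i ℤ.- δ c i) ℤ.* δ a j)
    eq xs p i j =
        -- The word `a w` has first letter `a` and the last letter of `w`; for `w a` it is the other
        -- way round. The outermost bracket therefore splits into a multiple of `final` and a
        -- multiple of `first`.
        trans (nest-nonempty (ι c) (ι d) xs {g = λ w → α ℤ.* final (ι j) w ℤ.- β ℤ.* first (ι i) w}
        λ y ys → cong (λ t → α ℤ.* final (ι j) (y ∷ ys) ℤ.- t)
          (trans (cong (first (ι i) (y ∷ ys) ℤ.*_) (cong (λ v → ⟦ does (≡-dec _≟_ v (just (ι j))) ⟧)
              (last-++ (y ∷ ys) (ι a))))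
            (ℤ.*-comm (first (ι i) (y ∷ ys)) β)))
      (trans (nest-minus (ι c) (ι d) xs _ _)
      (trans (cong₂ ℤ._-_ (trans (nest-* α (ι c) (ι d) xs (final (ι j)))
          (cong (α ℤ.*_) (nest-final (ι c) (ι d) xs (ι j))))
                          (trans (nest-* β (ι c) (ι d) xs (first (ι i)))
                              (trans (cong (β ℤ.*_) (nest-first (ι c) (ι d) xs (ι i)))
                                (ℤ.*-comm β _))))
      (trans (cong₂ ℤ._-_ (cong₂ ℤ._*_ (δ-ι a i) (cong₂ ℤ._-_ (δ-ι d j) (δ-ι c j)))
                   (cong₂ ℤ._*_ (cong (sgn (length xs) ℤ.*_) (cong₂ ℤ._-_ (δ-ι c i) (δ-ι d i)))
                       (δ-ι a j)))
      (trans (lemma (δ a i) (δ d j ℤ.- δ c j) (δ c i ℤ.- δ d i) (δ a j) (sgn (length xs)))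
        (cong₂ (λ m r → δ a i ℤ.* (δ d j ℤ.- δ c j) ℤ.- sgn m ℤ.* (r ℤ.* δ a j)) (sym (↭-length p))
            (neg (δ c i) (δ d i)))))))
      where
      α = δ (ι a) (ι i)
      β = δ (ι a) (ι j)

  type0 : ∀ c d → elems B ↭ ι c ∷ ι d ∷ [] →
          Realisable (λ i j → δ c i ℤ.* δ d j ℤ.- δ d i ℤ.* δ c j)
  type0 c d p = nested (ι c) (ι d) [] p _ λ i j →
    cong₂ ℤ._-_ (cong₂ ℤ._*_ (δ-ι c i) (δ-ι d j)) (cong₂ ℤ._*_ (δ-ι d i) (δ-ι c j))

-- Pivots for one subset

outerI : ∀ {k} (a c b d : Fin k) → Fin k → Fin k → ℤ
outerI a c b d i j = (δ a i ℤ.- δ c i) ℤ.* (δ d j ℤ.- δ b j)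

outerII : ∀ {k} (a c d : Fin k) → Fin k → Fin k → ℤ
outerII {k} a c d i j = δ a i ℤ.* (δ d j ℤ.- δ c j) ℤ.- sgn k ℤ.* ((δ d i ℤ.- δ c i) ℤ.* δ a j)

-- Abstracts from Realisable, whose dimension length (elems B) cannot be matched on.
record MatrixSpace (k : ℕ) : Set₁ where
  field
    Member  : (Fin k → Fin k → ℤ) → Set
    m-cong  : ∀ {M M′} → (∀ i j → M i j ≡ M′ i j) → Member M → Member M′
    m-minus : ∀ {M M′} → Member M → Member M′ → Member (λ i j → M i j ℤ.- M′ i j)
    m-+     : ∀ {M M′} → Member M → Member M′ → Member (λ i j → M i j ℤ.+ M′ i j)
    m-sgn   : ∀ {M} m → Member M → Member (λ i j → sgn m ℤ.* M i j)
    m-I     : ∀ a c b d → Unique (a ∷ c ∷ b ∷ d ∷ []) → Member (outerI a c b d)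
    m-II    : ∀ a c d → Unique (c ∷ d ∷ a ∷ []) → Member (outerII a c d)
    m-0     : ∀ c d → k ≡ 2 → Unique (c ∷ d ∷ []) →
              Member (λ i j → δ c i ℤ.* δ d j ℤ.- δ d i ℤ.* δ c j)

-- The number of entries listed by `Covered k`.
layerSize : ℕ → ℕ
layerSize 0 = 0
layerSize 1 = 0
layerSize 2 = 1
layerSize 3 = 2
layerSize k@(suc (suc (suc (suc m)))) = k ℕ.* (2 ℕ.+ m)

-- For k ≥ 4, the off-diagonal entries outside column 0, except (1 , 2).
Covered : ∀ {ℓ} k → (Fin k → Fin k → Set ℓ) → Set ℓ
Covered 0 P = Polymorphic.⊤
Covered 1 P = Polymorphic.⊤
Covered 2 P = P 0F 1F
Covered 3 P = P 0F 1F × P 0F 2F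
Covered (suc (suc (suc (suc m)))) P =
  (∀ i j → i ≢ j → P (suc (suc i)) (suc (suc j))) ×
  (∀ j → P 0F (suc j)) ×
  (∀ j → P 1F (suc (suc (suc j)))) ×
  (∀ i → P (suc (suc i)) 1F)

sgn-sq : ∀ k → sgn k ℤ.* sgn k ≡ 1ℤ
sgn-sq zero = refl
sgn-sq (suc k) = trans (lemma (sgn k)) (sgn-sq k)
  where
  lemma : ∀ s → ℤ.- s ℤ.* ℤ.- s ≡ s ℤ.* s
  lemma = solve-∀

δ-refl : ∀ {k} (i : Fin k) → δ i i ≡ 1ℤ
δ-refl i rewrite dec-true (i ≟ i) refl = refl

δ-≢ : ∀ {k} {i j : Fin k} → i ≢ j → δ i j ≡ 0ℤ
δ-≢ {i = i} {j} i≢j rewrite dec-false (i ≟ j) i≢j = refl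

II-0 : ∀ s {p q} → p ≡ 0ℤ → q ≡ 0ℤ → p ℤ.- s ℤ.* q ≡ 0ℤ
II-0 s refl refl = trans (ℤ.+-identityˡ _) (cong ℤ.-_ (ℤ.*-zeroʳ s))

unique₂ : ∀ {k} {a b : Fin k} → a ≢ b → Unique (a ∷ b ∷ [])
unique₂ p = (p ∷ []) ∷ [] ∷ []

unique₃ : ∀ {k} {a b c : Fin k} → a ≢ b → a ≢ c → b ≢ c → Unique (a ∷ b ∷ c ∷ [])
unique₃ p q r = (p ∷ q ∷ []) ∷ unique₂ r

unique₄ : ∀ {k} {a b c d : Fin k} → a ≢ b → a ≢ c → a ≢ d → b ≢ c → b ≢ d → c ≢ d →
          Unique (a ∷ b ∷ c ∷ d ∷ [])
unique₄ p q r s t u = (p ∷ q ∷ r ∷ []) ∷ unique₃ s t u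

module _ {k} (W : MatrixSpace k) where
  open MatrixSpace W

  record Pivot : Set where
    field
      row col  : Fin k
      row≢col  : row ≢ col
      matrix   : Fin k → Fin k → ℤ
      member   : Member matrix
      unit     : matrix row col ≡ 1ℤ

  open Pivot

  infix 4 _◁_
  _◁_ : Pivot → Pivot → Set
  p ◁ q = matrix q (row p) (col p) ≡ 0ℤ

  -- `covered` ties the list to the free entries: what holds at the pivot positions holds at all
  -- entries that `Covered` lists. It is applied with `P` the vanishing of a coordinate.
  record Layer ℓ : Set (lsuc ℓ) where
    field
      pivots     : List Pivot
      triangular : AllPairs _◁_ pivots
      size       : length pivots ≡ layerSize k
      covered    : ∀ {P : Fin k → Fin k → Set ℓ} →
                   All (λ p → P (row p) (col p)) pivots → Covered k P

open Pivot
open Layer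
open MatrixSpace

-- The `outerII` matrix has the sign of the subset size as its entry at (0 , 1); multiplying by the
-- same sign turns it into 1.
pivot01 : ∀ {k} (W : MatrixSpace (3 ℕ.+ k)) → Pivot W
pivot01 {k} W = record
  { row = 0F ; col = 1F ; row≢col = λ ()
  ; matrix = λ i j → sgn (3 ℕ.+ k) ℤ.* outerII 1F 0F 2F i j
  ; member = m-sgn W (3 ℕ.+ k) (m-II W 1F 0F 2F (unique₃ (λ ()) (λ ()) (λ ())))
  ; unit = trans (lemma (sgn (3 ℕ.+ k))) (sgn-sq (3 ℕ.+ k)) }
  where
  lemma : ∀ s → s ℤ.* (0ℤ ℤ.- s ℤ.* -1ℤ) ≡ s ℤ.* s
  lemma = solve-∀

pivot02 : ∀ {k} (W : MatrixSpace (3 ℕ.+ k)) → Pivot W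
pivot02 {k} W = record
  { row = 0F ; col = 2F ; row≢col = λ ()
  ; matrix = λ i j → sgn (3 ℕ.+ k) ℤ.* outerII 2F 0F 1F i j
  ; member = m-sgn W (3 ℕ.+ k) (m-II W 2F 0F 1F (unique₃ (λ ()) (λ ()) (λ ())))
  ; unit = trans (lemma (sgn (3 ℕ.+ k))) (sgn-sq (3 ℕ.+ k)) }
  where
  lemma : ∀ s → s ℤ.* (0ℤ ℤ.- s ℤ.* -1ℤ) ≡ s ℤ.* s
  lemma = solve-∀

sgn*0 : ∀ s t {p} → p ≡ 0ℤ → s ℤ.* (p ℤ.- t ℤ.* 0ℤ) ≡ 0ℤ
sgn*0 s t refl = lemma s t
  where
  lemma : ∀ s t → s ℤ.* (0ℤ ℤ.- t ℤ.* 0ℤ) ≡ 0ℤ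
  lemma = solve-∀

pivot01◁pivot02 : ∀ {k} (W : MatrixSpace (3 ℕ.+ k)) → _◁_ W (pivot01 W) (pivot02 W)
pivot01◁pivot02 {k} W = sgn*0 (sgn (3 ℕ.+ k)) (sgn (3 ℕ.+ k)) refl

module Large {m} (W : MatrixSpace (4 ℕ.+ m)) where

  private
    k = 4 ℕ.+ m
    s = sgn k

  -- The other three nonzero entries lie in row 1 or column 0, away from all positions of this
  -- family.
  inner : Fin (2 ℕ.+ m) → Fin (1 ℕ.+ m) → Pivot W
  inner c d = record
    { row = suc (suc c) ; col = suc (suc (punchIn c d))
    ; row≢col = punchInᵢ≢i c d ∘ sym ∘ suc-injective ∘ suc-injective
    ; matrix = outerI (suc (suc c)) 1F 0F (suc (suc (punchIn c d)))
    ; member = m-I W (suc (suc c)) 1F 0F (suc (suc (punchIn c d)))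
        (unique₄ (λ ()) (λ ()) (punchInᵢ≢i c d ∘ sym ∘ suc-injective ∘ suc-injective) (λ ()) (λ ())
          (λ ()))
    ; unit = cong₂ (λ x y → (x ℤ.- 0ℤ) ℤ.* (y ℤ.- 0ℤ)) (δ-refl c) (δ-refl (punchIn c d)) }

  -- The other nonzero entries are at (1 , d + 3) and (0 , 2), where later pivots sit, and at (1 ,
  -- 2), which is not free.
  top : Fin (1 ℕ.+ m) → Pivot W
  top d = record
    { row = 0F ; col = suc (suc (suc d)) ; row≢col = λ ()
    ; matrix = outerI 0F 1F 2F (suc (suc (suc d)))
    ; member = m-I W 0F 1F 2F (suc (suc (suc d)))
        (unique₄ (λ ()) (λ ()) (λ ()) (λ ()) (λ ()) (λ ()))
    ; unit = cong (λ x → 1ℤ ℤ.* (x ℤ.- 0ℤ)) (δ-refl d) }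

  -- The other nonzero entries are at (d + 3 , 1) and (2 , 1), where later pivots sit, and at (1 ,
  -- 2).
  second : Fin (1 ℕ.+ m) → Pivot W
  second d = record
    { row = 1F ; col = suc (suc (suc d)) ; row≢col = λ ()
    ; matrix = outerII 1F 2F (suc (suc (suc d)))
    ; member = m-II W 1F 2F (suc (suc (suc d))) (unique₃ (λ ()) (λ ()) (λ ()))
    ; unit = trans (cong (λ x → 1ℤ ℤ.* (x ℤ.- 0ℤ) ℤ.- s ℤ.* 0ℤ) (δ-refl d)) (lemma s) }
    where
    lemma : ∀ s → 1ℤ ℤ.- s ℤ.* 0ℤ ≡ 1ℤ
    lemma = solve-∀

  -- The other nonzero entries are at (2 , 1), the position of `corner`, and in column 0.
  left : Fin (1 ℕ.+ m) → Pivot W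
  left c = record
    { row = suc (suc (suc c)) ; col = 1F ; row≢col = λ ()
    ; matrix = outerI (suc (suc (suc c))) 2F 0F 1F
    ; member = m-I W (suc (suc (suc c))) 2F 0F 1F
        (unique₄ (λ ()) (λ ()) (λ ()) (λ ()) (λ ()) (λ ()))
    ; unit = cong (λ x → (x ℤ.- 0ℤ) ℤ.* 1ℤ) (δ-refl c) }

  -- The last pivot has to vanish at all other free entries. A signed sum of four commutator
  -- matrices, all involving index 3, achieves this: the terms with index 3 cancel, and besides (2 ,
  -- 1) only (1 , 2) and entries of column 0 remain.
  corner : Pivot W
  corner = record
    { row = 2F ; col = 1F ; row≢col = λ ()
    ; matrix = M
    ; member = m-cong W
        (λ i j → identity s (δ 0F i) (δ 1F i) (δ 2F i) (δ 3F i)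
                            (δ 0F j) (δ 1F j) (δ 2F j) (δ 3F j))
        (m-+ W (m-minus W
            (m-+ W (m-I W 2F 3F 0F 1F (unique₄ (λ ()) (λ ()) (λ ()) (λ ()) (λ ()) (λ ())))
                             (m-II W 3F 2F 1F (unique₃ (λ ()) (λ ()) (λ ()))))
                      (m-sgn W k (m-I W 1F 2F 3F 0F
                          (unique₄ (λ ()) (λ ()) (λ ()) (λ ()) (λ ()) (λ ())))))
               (m-I W 3F 1F 0F 2F (unique₄ (λ ()) (λ ()) (λ ()) (λ ()) (λ ()) (λ ()))))
    ; unit = lemma s }
    where
    M : Fin k → Fin k → ℤ
    M i j = (δ 2F i ℤ.* δ 1F j ℤ.- δ 1F i ℤ.* δ 2F j) ℤ.+
            (s ℤ.- 1ℤ) ℤ.* ((δ 2F i ℤ.- δ 1F i) ℤ.* δ 0F j)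
    lemma : ∀ s → 1ℤ ℤ.+ (s ℤ.- 1ℤ) ℤ.* 0ℤ ≡ 1ℤ
    lemma = solve-∀
    identity : ∀ s a₀ a₁ a₂ a₃ b₀ b₁ b₂ b₃ →
      (a₂ ℤ.- a₃) ℤ.* (b₁ ℤ.- b₀) ℤ.+ (a₃ ℤ.* (b₁ ℤ.- b₂) ℤ.- s ℤ.* ((a₁ ℤ.- a₂) ℤ.* b₃))
        ℤ.- s ℤ.* ((a₁ ℤ.- a₂) ℤ.* (b₀ ℤ.- b₃)) ℤ.+ (a₃ ℤ.- a₁) ℤ.* (b₂ ℤ.- b₀) ≡
      (a₂ ℤ.* b₁ ℤ.- a₁ ℤ.* b₂) ℤ.+ (s ℤ.- 1ℤ) ℤ.* ((a₂ ℤ.- a₁) ℤ.* b₀)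
    identity = solve-∀

  inner′ : Fin ((2 ℕ.+ m) ℕ.* (1 ℕ.+ m)) → Pivot W
  inner′ = uncurry inner ∘ remQuot {2 ℕ.+ m} (1 ℕ.+ m)

  pivots₁ pivots₂ pivots₃ pivots₄ pivots₅ : List (Pivot W)
  pivots₅ = pivot01 W ∷ pivot02 W ∷ corner ∷ []
  pivots₄ = tabulate left ++ pivots₅
  pivots₃ = tabulate second ++ pivots₄
  pivots₂ = tabulate top ++ pivots₃
  pivots₁ = tabulate inner′ ++ pivots₂

  infix 4 _◂_
  _◂_ : Pivot W → Pivot W → Set
  _◂_ = _◁_ W

  0ᵣ : ∀ t → t ℤ.* 0ℤ ≡ 0ℤ
  0ᵣ = ℤ.*-zeroʳ

  sII-0 : ∀ {p q} → p ≡ 0ℤ → q ≡ 0ℤ → s ℤ.* (p ℤ.- s ℤ.* q) ≡ 0ℤ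
  sII-0 p≡0 q≡0 = trans (cong (s ℤ.*_) (II-0 s p≡0 q≡0)) (ℤ.*-zeroʳ s)

  prepend : ∀ {a} (f : Fin a → Pivot W) {ps} → (∀ {i j} → i ≢ j → f i ◂ f j) →
            (∀ i → All (f i ◂_) ps) → AllPairs _◂_ ps → AllPairs _◂_ (tabulate f ++ ps)
  prepend f within before tri = AllPairs.++⁺ (AllPairs.tabulate⁺ within) tri (All.tabulate⁺ before)

  each : ∀ {a} p (f : Fin a → Pivot W) {ps} → (∀ i → p ◂ f i) → All (p ◂_) ps →
      All (p ◂_) (tabulate f ++ ps)
  each p f h = All.++⁺ (All.tabulate⁺ h)

  inner◂inner : ∀ c d c′ d′ → (c , d) ≢ (c′ , d′) → inner c d ◂ inner c′ d′
  inner◂inner c d c′ d′ ≢ with c′ ≟ c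
  ... | no _ = refl
  ... | yes refl =
      cong (λ x → 1ℤ ℤ.* (x ℤ.- 0ℤ))
        (δ-≢ (λ e → ≢ (cong (c ,_) (sym (punchIn-injective c d′ d e)))))

  inner′◂inner′ : ∀ {i j} → i ≢ j → inner′ i ◂ inner′ j
  inner′◂inner′ {i} {j} i≢j = inner◂inner (proj₁ (split i)) (proj₂ (split i)) (proj₁ (split j))
      (proj₂ (split j)) λ e → i≢j (trans (sym (combine-remQuot (1 ℕ.+ m) i))
    (trans (cong (uncurry combine) e) (combine-remQuot (1 ℕ.+ m) j)))
    where
    split : Fin ((2 ℕ.+ m) ℕ.* (1 ℕ.+ m)) → Fin (2 ℕ.+ m) × Fin (1 ℕ.+ m)
    split = remQuot {2 ℕ.+ m} (1 ℕ.+ m)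

  corner-0 : ∀ s → 0ℤ ℤ.+ (s ℤ.- 1ℤ) ℤ.* 0ℤ ≡ 0ℤ
  corner-0 = solve-∀

  inner◂corner : ∀ c d → inner c d ◂ corner
  inner◂corner c d = lemma s (δ 2F (suc (suc c)))
    where
    lemma : ∀ s t → (t ℤ.* 0ℤ ℤ.- 0ℤ) ℤ.+ (s ℤ.- 1ℤ) ℤ.* ((t ℤ.- 0ℤ) ℤ.* 0ℤ) ≡ 0ℤ
    lemma = solve-∀

  inner◂ : ∀ c d → All (inner c d ◂_) pivots₂
  inner◂ c d =
    each (inner c d) top (λ _ → refl)
    (each (inner c d) second (λ j → II-0 s refl (0ᵣ (δ (suc (suc (suc j))) x ℤ.- δ 2F x)))
    (each (inner c d) left (λ j → 0ᵣ (δ (suc (suc (suc j))) x ℤ.- δ 2F x))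
    (sII-0 refl (0ᵣ (δ 2F x ℤ.- 0ℤ)) ∷ sII-0 (0ᵣ (δ 2F x)) refl ∷ inner◂corner c d ∷ [])))
    where
    x : Fin k
    x = suc (suc c)

  second◂second : ∀ {i j} → i ≢ j → second i ◂ second j
  second◂second i≢j = II-0 s (cong (λ x → 1ℤ ℤ.* (x ℤ.- 0ℤ)) (δ-≢ (i≢j ∘ sym))) refl

  triangular₁ : AllPairs _◂_ pivots₁
  triangular₁ =
    prepend inner′ inner′◂inner′ (λ i → let c , d = remQuot {2 ℕ.+ m} (1 ℕ.+ m) i in inner◂ c d)
    (prepend top (λ i≢j → cong (λ x → 1ℤ ℤ.* (x ℤ.- 0ℤ)) (δ-≢ (i≢j ∘ sym)))
      (λ i → each (top i) second (λ _ → II-0 s refl refl) (each (top i) left (λ _ → refl)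
             (sII-0 refl refl ∷ sII-0 refl refl ∷ corner-0 s ∷ [])))
    (prepend second second◂second
      (λ i → each (second i) left (λ _ → refl)
          (sII-0 refl refl ∷ sII-0 refl refl ∷ corner-0 s ∷ []))
    (prepend left (λ i≢j → cong (λ x → (x ℤ.- 0ℤ) ℤ.* 1ℤ) (δ-≢ (i≢j ∘ sym)))
      (λ _ → sII-0 refl refl ∷ sII-0 refl refl ∷ corner-0 s ∷ [])
    ((pivot01◁pivot02 W ∷ corner-0 s ∷ []) ∷ (corner-0 s ∷ []) ∷ [] ∷ []))))

  length-prepend : ∀ {a b} (f : Fin a → Pivot W) {ps} → length ps ≡ b →
      length (tabulate f ++ ps) ≡ a ℕ.+ b
  length-prepend f {ps} eq = trans (List.length-++ (tabulate f))
      (cong₂ ℕ._+_ (List.length-tabulate f) eq)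

  size₁ : length pivots₁ ≡ layerSize k
  size₁ = trans
      (length-prepend inner′
        (length-prepend top (length-prepend second (length-prepend left refl)))) (count m)
    where
    count : ∀ m → (2 ℕ.+ m) ℕ.* (1 ℕ.+ m) ℕ.+ (1 ℕ.+ m ℕ.+ (1 ℕ.+ m ℕ.+ (1 ℕ.+ m ℕ.+ 3))) ≡
        (4 ℕ.+ m) ℕ.* (2 ℕ.+ m)
    count = ℕ-Solver.solve-∀

  covered₁ : ∀ {ℓ} {P : Fin k → Fin k → Set ℓ} → All (λ p → P (row p) (col p)) pivots₁ → Covered k P
  covered₁ {P = P} ps₁ =
    let qs₁ , ps₂ = All.++⁻ (tabulate inner′) ps₁
        qs₂ , ps₃ = All.++⁻ (tabulate top) ps₂
        qs₃ , ps₄ = All.++⁻ (tabulate second) ps₃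
        qs₄ , ps₅ = All.++⁻ (tabulate left) ps₄
        inner-P : ∀ c d → P (suc (suc c)) (suc (suc (punchIn c d)))
        inner-P c d = subst (λ (c , d) → P (suc (suc c)) (suc (suc (punchIn c d))))
            (remQuot-combine c d)
          (All.tabulate⁻ {f = inner′} qs₁ (combine c d))
    in from-pivots₅ ps₅ λ p01 p02 p21 →
    (λ i j i≢j → subst (λ j → P (suc (suc i)) (suc (suc j))) (punchIn-punchOut i≢j)
        (inner-P i (punchOut i≢j))) ,
    (λ { 0F → p01 ; 1F → p02 ; (suc (suc j)) → All.tabulate⁻ {f = top} qs₂ j }) ,
    All.tabulate⁻ {f = second} qs₃ ,
    (λ { 0F → p21 ; (suc i) → All.tabulate⁻ {f = left} qs₄ i })
    where
    from-pivots₅ : ∀ {ℓ} {X : Set ℓ} → All (λ p → P (row p) (col p)) pivots₅ →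
        (P 0F 1F → P 0F 2F → P 2F 1F → X) → X
    from-pivots₅ (p ∷ q ∷ r ∷ []) f = f p q r

layer : ∀ {ℓ} k (W : MatrixSpace k) → Layer W ℓ
layer 0 W = record { pivots = [] ; triangular = [] ; size = refl ; covered = _ }
layer 1 W = record { pivots = [] ; triangular = [] ; size = refl ; covered = _ }
layer 2 W = record
  { pivots = record
      { row = 0F ; col = 1F ; row≢col = λ () ; matrix = λ i j →
          δ 0F i ℤ.* δ 1F j ℤ.- δ 1F i ℤ.* δ 0F j
      ; member = m-0 W 0F 1F refl (unique₂ λ ()) ; unit = refl } ∷ []
  ; triangular = [] ∷ [] ; size = refl ; covered = λ { (p ∷ []) → p } }
layer 3 W = record
  { pivots = pivot01 W ∷ pivot02 W ∷ []
  ; triangular = (pivot01◁pivot02 W ∷ []) ∷ [] ∷ [] ; size = refl ; covered =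
      λ { (p ∷ q ∷ []) → p , q } }
layer (suc (suc (suc (suc m)))) W = record
  { pivots = pivots₁ ; triangular = triangular₁ ; size = size₁ ; covered = covered₁ }
  where open Large W

-- The order of a ranking

module _ {A : Set} where

  head-∈ : ∀ (xs : List A) {a} → head xs ≡ just a → a ∈ₗ xs
  head-∈ (_ ∷ _) refl = here refl

  last-∈ : ∀ (xs : List A) {b} → last xs ≡ just b → b ∈ₗ xs
  last-∈ (_ ∷ []) refl = here refl
  last-∈ (_ ∷ y ∷ ys) eq = there (last-∈ (y ∷ ys) eq)

  head-exists : ∀ {xs : List A} {x} → x ∈ₗ xs → ∃[ a ] head xs ≡ just a
  head-exists {_ ∷ _} _ = _ , refl

  last-exists : ∀ {xs : List A} {x} → x ∈ₗ xs → ∃[ b ] last xs ≡ just b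
  last-exists {_ ∷ []} _ = _ , refl
  last-exists {_ ∷ y ∷ ys} _ = last-exists {y ∷ ys} (here refl)

module _ {A : Set} {_~_ : A → A → Set} where

  head-first : ∀ {xs a x} → AllPairs _~_ xs → head xs ≡ just a → x ∈ₗ xs → x ≢ a → a ~ x
  head-first (a~ ∷ _) refl (here refl) x≢a = contradiction refl x≢a
  head-first (a~ ∷ _) refl (there x∈) x≢a = All.lookup a~ x∈

  last-last : ∀ {xs b x} → AllPairs _~_ xs → last xs ≡ just b → x ∈ₗ xs → x ≢ b → x ~ b
  last-last {_ ∷ []} _ refl (here refl) x≢b = contradiction refl x≢b
  last-last {_ ∷ y ∷ ys} (_ ∷ ps) eq (there x∈) x≢b = last-last ps eq x∈ x≢b
  last-last {x ∷ y ∷ ys} (x~ ∷ ps) eq (here refl) x≢b = All.lookup x~ (last-∈ (y ∷ ys) eq)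

module Order (π : Ranking n) where

  infix 4 _≺_ _≺?_
  -- `π ⟨$⟩ˡ x` is the position of `x` in the word, so smaller means better.
  _≺_ : Fin n → Fin n → Set
  x ≺ y = (π ⟨$⟩ˡ x) Fin.< (π ⟨$⟩ˡ y)

  _≺?_ : ∀ x y → Dec (x ≺ y)
  x ≺? y = (π ⟨$⟩ˡ x) <? (π ⟨$⟩ˡ y)

  ≺-asym : ∀ {x y} → x ≺ y → ¬ y ≺ x
  ≺-asym = <-asym

  ≺-trans : ∀ {x y z} → x ≺ y → y ≺ z → x ≺ z
  ≺-trans = <-trans

  ≺-total : ∀ {x y} → x ≢ y → x ≺ y ⊎ y ≺ x
  ≺-total {x} {y} x≢y with <-cmp (π ⟨$⟩ˡ x) (π ⟨$⟩ˡ y)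
  ... | tri< x≺y _ _ = inj₁ x≺y
  ... | tri> _ _ y≺x = inj₂ y≺x
  ... | tri≈ _ eq _  =
      contradiction (trans (sym (inverseʳ π)) (trans (cong (π ⟨$⟩ʳ_) eq) (inverseʳ π))) x≢y

  word-sorted : AllPairs _≺_ (word π)
  word-sorted = AllPairs.tabulate⁺-< λ i<j → subst₂ Fin._<_ (sym (inverseˡ π))
      (sym (inverseˡ π)) i<j

  module _ (B : Subset n) where

    restriction-sorted : AllPairs _≺_ (π ↾ B)
    restriction-sorted = AllPairs.filter⁺ (_∈? B) word-sorted

    ∈-restriction⁺ : ∀ {x} → x ∈ B → x ∈ₗ π ↾ B
    ∈-restriction⁺ {x} x∈B = ∈-filter⁺ (_∈? B)
      (subst (_∈ₗ word π) (inverseʳ π) (∈-tabulate⁺ (π ⟨$⟩ˡ x))) x∈B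

    ∈-restriction⁻ : ∀ {x} → x ∈ₗ π ↾ B → x ∈ B
    ∈-restriction⁻ x∈ = proj₂ (∈-filter⁻ (_∈? B) {xs = word π} x∈)

    best⁻ : ∀ {a} → Best π B a → a ∈ B × (∀ {x} → x ∈ B → x ≢ a → a ≺ x)
    best⁻ eq = ∈-restriction⁻ (head-∈ (π ↾ B) eq) ,
               λ x∈B → head-first restriction-sorted eq (∈-restriction⁺ x∈B)

    worst⁻ : ∀ {b} → Worst π B b → b ∈ B × (∀ {x} → x ∈ B → x ≢ b → x ≺ b)
    worst⁻ eq = ∈-restriction⁻ (last-∈ (π ↾ B) eq) ,
                λ x∈B → last-last restriction-sorted eq (∈-restriction⁺ x∈B)

    best-exists : ∀ {x} → x ∈ B → ∃[ a ] Best π B a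
    best-exists x∈B = head-exists (∈-restriction⁺ x∈B)

    worst-exists : ∀ {x} → x ∈ B → ∃[ b ] Worst π B b
    worst-exists x∈B = last-exists (∈-restriction⁺ x∈B)

    best⁺ : ∀ {a} → a ∈ B → (∀ {x} → x ∈ B → x ≢ a → a ≺ x) → Best π B a
    -- Some best element exists; if it were not `a`, each of the two would precede the other.
    best⁺ {a} a∈B a≺ with a′ , best ← best-exists a∈B with a ≟ a′
    ... | yes refl = best
    ... | no a≢a′ = contradiction (proj₂ (best⁻ best) a∈B a≢a′)
        (≺-asym (a≺ (proj₁ (best⁻ best)) (a≢a′ ∘ sym)))

    worst⁺ : ∀ {b} → b ∈ B → (∀ {x} → x ∈ B → x ≢ b → x ≺ b) → Worst π B b
    worst⁺ {b} b∈B ≺b with b′ , worst ← worst-exists b∈B with b ≟ b′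
    ... | yes refl = worst
    ... | no b≢b′ = contradiction (proj₂ (worst⁻ worst) b∈B b≢b′)
        (≺-asym (≺b (proj₁ (worst⁻ worst)) (b≢b′ ∘ sym)))

    best? : ∀ a → Dec (Best π B a)
    best? a = ≡-dec _≟_ (head (π ↾ B)) (just a)

    worst? : ∀ b → Dec (Worst π B b)
    worst? b = ≡-dec _≟_ (last (π ↾ B)) (just b)

    best-unique : ∀ {a a′} → Best π B a → Best π B a′ → a ≡ a′
    best-unique p q = just-injective (trans (sym p) q)

    worst-unique : ∀ {b b′} → Worst π B b → Worst π B b′ → b ≡ b′
    worst-unique p q = just-injective (trans (sym p) q)

    best≢worst : ∀ {x y a} → x ∈ B → y ∈ B → x ≢ y → Best π B a → ¬ Worst π B a
    best≢worst {x} {y} {a} x∈B y∈B x≢y best worst with x ≟ a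
    ... | no x≢a = ≺-asym (proj₂ (best⁻ best) x∈B x≢a) (proj₂ (worst⁻ worst) x∈B x≢a)
    ... | yes refl = ≺-asym (proj₂ (best⁻ best) y∈B (x≢y ∘ sym))
        (proj₂ (worst⁻ worst) y∈B (x≢y ∘ sym))

  BestWorst : Subset n → Fin n → Fin n → Set
  BestWorst B a b = Best π B a × Worst π B b

  bw? : ∀ B a b → Dec (BestWorst B a b)
  bw? B a b = best? B a ×-dec worst? B b

  -- Interpolates between the two extremes: for `C` the singleton of `a` and `Q` the rest of `B` it
  -- says that `a` is best in `B`; for `C` equal to `B` and `Q` empty, that `a` is worst in `B`.
  WorstBefore : Fin n → Subset n → List (Fin n) → Set
  WorstBefore a C Q = Worst π C a × All (a ≺_) Q

  worstBefore? : ∀ a C Q → Dec (WorstBefore a C Q)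
  worstBefore? a C Q = worst? C a ×-dec All.all? (a ≺?_) Q

  module _ {a : Fin n} {C : Subset n} {q : Fin n} (a∈C : a ∈ C) (q∉C : q ∉ C) where

    private
      q≢a : q ≢ a
      q≢a refl = q∉C a∈C

    -- The order of `a` and `q` decides between two exclusive cases. This and the next three lemmas
    -- are the hypotheses of `⟨⟩-split` for that decomposition.
    worstBefore-split : ∀ {Q} → WorstBefore a C Q → WorstBefore a C (q ∷ Q) ⊎ WorstBefore a
        (C ∪ ⁅ q ⁆) Q
    worstBefore-split (worst , a≺Q) with ≺-total q≢a
    ... | inj₂ a≺q = inj₁ (worst , a≺q ∷ a≺Q)
    ... | inj₁ q≺a = inj₂ (worst⁺ (C ∪ ⁅ q ⁆) (x∈p∪q⁺ (inj₁ a∈C)) (λ x∈ x≢a →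
          [ (λ x∈C → proj₂ (worst⁻ C worst) x∈C x≢a) , (λ x∈q →
              subst (_≺ a) (sym (x∈⁅y⁆⇒x≡y q x∈q)) q≺a) ]′ (x∈p∪q⁻ C ⁅ q ⁆ x∈)) , a≺Q)

    worstBefore-tail : ∀ {Q} → WorstBefore a C (q ∷ Q) → WorstBefore a C Q
    worstBefore-tail (worst , _ ∷ a≺Q) = worst , a≺Q

    worstBefore-shrink : ∀ {Q} → WorstBefore a (C ∪ ⁅ q ⁆) Q → WorstBefore a C Q
    worstBefore-shrink (worst , a≺Q) =
      worst⁺ C a∈C (λ x∈C → proj₂ (worst⁻ (C ∪ ⁅ q ⁆) worst) (x∈p∪q⁺ (inj₁ x∈C))) , a≺Q

    worstBefore-exclusive : ∀ {Q} → WorstBefore a C (q ∷ Q) → ¬ WorstBefore a (C ∪ ⁅ q ⁆) Q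
    worstBefore-exclusive (_ , a≺q ∷ _) (worst , _) =
      ≺-asym a≺q (proj₂ (worst⁻ (C ∪ ⁅ q ⁆) worst) (x∈p∪q⁺ (inj₂ (x∈⁅x⁆ q))) q≢a)

  module _ {B : Subset n} {a b c} (a∈B : a ∈ B) (b∈B : b ∈ B) (c∈B : c ∈ B)
           (only : ∀ {x} → x ∈ B → x ≡ a ⊎ x ≡ b ⊎ x ≡ c)
           (a≢b : a ≢ b) (a≢c : a ≢ c) (b≢c : b ≢ c) where

    pair : Subset n
    pair = ⁅ a ⁆ ∪ ⁅ b ⁆

    bw-pair : ∀ {x y} → x ∈ B → y ∈ B →
        (∀ {z} → z ≡ a ⊎ z ≡ b ⊎ z ≡ c → (z ≢ x → x ≺ z) × (z ≢ y → z ≺ y)) → BestWorst B x y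
    bw-pair x∈B y∈B f = best⁺ B x∈B (λ z∈B → proj₁ (f (only z∈B))) , worst⁺ B y∈B
        (λ z∈B → proj₂ (f (only z∈B)))

    a∈pair : a ∈ pair
    a∈pair = x∈p∪q⁺ (inj₁ (x∈⁅x⁆ a))

    b∈pair : b ∈ pair
    b∈pair = x∈p∪q⁺ {p = ⁅ a ⁆} (inj₂ (x∈⁅x⁆ b))

    pair⁻ : ∀ {x} → x ∈ pair → x ≡ a ⊎ x ≡ b
    pair⁻ x∈ = Sum.map (x∈⁅y⁆⇒x≡y a) (x∈⁅y⁆⇒x≡y b) (x∈p∪q⁻ ⁅ a ⁆ ⁅ b ⁆ x∈)

    pair⁺ : a ≺ b → BestWorst pair a b
    pair⁺ a≺b = best⁺ pair a∈pair (λ x∈ x≢a → [ (λ e → contradiction e x≢a) , (λ { refl → a≺b }) ]′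
        (pair⁻ x∈))
              , worst⁺ pair b∈pair (λ x∈ x≢b → [ (λ { refl → a≺b }) , (λ e → contradiction e x≢b) ]′
                  (pair⁻ x∈))

    -- The place of `c` decides: between `a` and `b`, after `b`, or before `a`.
    triple-split : BestWorst pair a b → BestWorst B a b ⊎ BestWorst B a c ⊎ BestWorst B c b
    triple-split (best , _) with proj₂ (best⁻ pair best) b∈pair (a≢b ∘ sym) | ≺-total a≢c | ≺-total
        b≢c
    ... | a≺b | inj₂ c≺a | _ = inj₂ (inj₂ (bw-pair c∈B b∈B λ where
            (inj₁ refl) → (λ _ → c≺a) , (λ _ → a≺b)
            (inj₂ (inj₁ refl)) → (λ _ → ≺-trans c≺a a≺b) , contradiction refl
            (inj₂ (inj₂ refl)) → contradiction refl , (λ _ → ≺-trans c≺a a≺b)))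
    ... | a≺b | inj₁ a≺c | inj₁ b≺c = inj₂ (inj₁ (bw-pair a∈B c∈B λ where
            (inj₁ refl) → contradiction refl , (λ _ → a≺c)
            (inj₂ (inj₁ refl)) → (λ _ → a≺b) , (λ _ → b≺c)
            (inj₂ (inj₂ refl)) → (λ _ → a≺c) , contradiction refl))
    ... | a≺b | inj₁ a≺c | inj₂ c≺b = inj₁ (bw-pair a∈B b∈B λ where
            (inj₁ refl) → contradiction refl , (λ _ → a≺b)
            (inj₂ (inj₁ refl)) → (λ _ → a≺b) , contradiction refl
            (inj₂ (inj₂ refl)) → (λ _ → a≺c) , (λ _ → c≺b))

    triple-join₁ : BestWorst B a b → BestWorst pair a b
    triple-join₁ (best , _) = pair⁺ (proj₂ (best⁻ B best) b∈B (a≢b ∘ sym))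

    triple-join₂ : BestWorst B a c ⊎ BestWorst B c b → BestWorst pair a b
    triple-join₂ (inj₁ (best , _)) = pair⁺ (proj₂ (best⁻ B best) b∈B (a≢b ∘ sym))
    triple-join₂ (inj₂ (_ , worst)) = pair⁺ (proj₂ (worst⁻ B worst) a∈B a≢b)

private
  variable
    ℓp ℓq ℓr : Level

-- Linear relations in the direction space

module Real {c ℓ₁ ℓ₂ ℓ₃} (ℝ : Reals c ℓ₁ ℓ₂ ℓ₃) where

  open Reals ℝ using (ring)
  open CommutativeRing ring public hiding (ring; zero)
    renaming (refl to ≈-refl; sym to ≈-sym; trans to ≈-trans)
  open RingProperties (CommutativeRing.ring ring) public using
      (-0#≈0#; -‿involutive; -‿+-comm; -‿distribˡ-*; x+x≈x⇒x≈0)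
  open SemiringSum semiring public using (sum; sum-cong-≋)

  +-zero : ∀ {x y} → x ≈ 0# → y ≈ 0# → x + y ≈ 0#
  +-zero x≈0 y≈0 = ≈-trans (+-cong x≈0 y≈0) (+-identityˡ 0#)

  drop-left : ∀ {x y z} → z ≈ x + y → x ≈ 0# → z ≈ y
  drop-left z≈ x≈0 = ≈-trans z≈ (≈-trans (+-congʳ x≈0) (+-identityˡ _))

  drop-right : ∀ {x y z} → z ≈ x + y → y ≈ 0# → z ≈ x
  drop-right z≈ y≈0 = ≈-trans z≈ (≈-trans (+-congˡ y≈0) (+-identityʳ _))

  right-zero : ∀ {x y z} → z ≈ x + y → z ≈ 0# → x ≈ 0# → y ≈ 0#
  right-zero z≈ z≈0 x≈0 = ≈-trans (≈-sym (drop-left z≈ x≈0)) z≈0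

  left-zero : ∀ {x y z} → z ≈ x + y → z ≈ 0# → y ≈ 0# → x ≈ 0#
  left-zero z≈ z≈0 y≈0 = ≈-trans (≈-sym (drop-right z≈ y≈0)) z≈0

  sum-zero : ∀ {k} (f : Fin k → Carrier) → (∀ i → f i ≈ 0#) → sum f ≈ 0#
  sum-zero {zero} f f≈0 = ≈-refl
  sum-zero {suc k} f f≈0 = +-zero (f≈0 zero) (sum-zero (f ∘ suc) (f≈0 ∘ suc))

  sum-single : ∀ {k} (f : Fin k → Carrier) j → (∀ i → i ≢ j → f i ≈ 0#) → sum f ≈ f j
  sum-single f zero f≈0 = drop-right ≈-refl (sum-zero (f ∘ suc) λ i → f≈0 (suc i) λ ())
  sum-single f (suc j) f≈0 =
      drop-left (+-congˡ (sum-single (f ∘ suc) j λ i i≢j → f≈0 (suc i) (i≢j ∘ suc-injective)))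
        (f≈0 zero λ ())

  -- The relations on a block once all smaller blocks vanish. That a row sum equals the column sum
  -- up to sign is recorded only as equivalence of vanishing, which avoids tracking the sign.
  record Relations {k} (μ : Fin k → Fin k → Carrier) : Set ℓ₁ where
    field
      diagonal : ∀ i → μ i i ≈ 0#
      col⇒row  : ∀ i → sum (λ j → μ j i) ≈ 0# → sum (μ i) ≈ 0#
      row⇒col  : ∀ i → sum (μ i) ≈ 0# → sum (λ j → μ j i) ≈ 0#
      total    : sum (λ i → sum (μ i)) ≈ 0#
      triple   : k ≡ 3 → ∀ {i j l} → i ≢ j → i ≢ l → j ≢ l → μ i j + (μ i l + μ l j) ≈ 0#

  determined : ∀ {k} (μ : Fin k → Fin k → Carrier) → Relations μ →
               Covered k (λ i j → μ i j ≈ 0#) → ∀ i j → i ≢ j → μ i j ≈ 0#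
  determined {1} μ rel _ 0F 0F i≢j = contradiction refl i≢j
  determined {2} μ rel μ01 = λ where
      0F 0F i≢j → contradiction refl i≢j
      0F 1F _ → μ01
      1F 0F _ → μ10
      1F 1F i≢j → contradiction refl i≢j
    where
    open Relations rel
    row₀ : sum (μ 0F) ≈ 0#
    row₀ = sum-zero (μ 0F) λ { 0F → diagonal 0F ; 1F → μ01 }
    μ10 : μ 1F 0F ≈ 0#
    μ10 = ≈-trans
        (≈-sym (sum-single (μ 1F) 0F λ { 0F 0≢0 → contradiction refl 0≢0 ; 1F _ → diagonal 1F }))
      (≈-trans (≈-sym
          (sum-single (λ i → sum (μ i)) 1F λ { 0F _ → row₀ ; 1F 1≢1 → contradiction refl 1≢1 }))
            total)
  determined {3} μ rel (μ01 , μ02) = λ where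
      0F 0F i≢j → contradiction refl i≢j
      0F 1F _ → μ01
      0F 2F _ → μ02
      1F 0F _ → left-zero ≈-refl (triple refl {1F} {0F} {2F} (λ ()) (λ ()) (λ ())) (+-zero μ12 μ20)
      1F 1F i≢j → contradiction refl i≢j
      1F 2F _ → μ12
      2F 0F _ → μ20
      2F 1F _ → μ21
      2F 2F i≢j → contradiction refl i≢j
    where
    open Relations rel
    -- The remaining entries come from triple relations, each used when a single one of its entries
    -- is still unknown. `μ12+μ20` serves to show that `μ 1F 0F` vanishes, which `μ20` needs.
    μ21 : μ 2F 1F ≈ 0#
    μ21 = right-zero ≈-refl
        (right-zero ≈-refl (triple refl {0F} {1F} {2F} (λ ()) (λ ()) (λ ())) μ01) μ02
    μ12+μ20 : μ 1F 2F + (μ 1F 0F + μ 0F 2F) ≈ 0#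
    μ12+μ20 = triple refl {1F} {2F} {0F} (λ ()) (λ ()) (λ ())
    μ12 : μ 1F 2F ≈ 0#
    μ12 = right-zero ≈-refl
        (right-zero ≈-refl (triple refl {0F} {2F} {1F} (λ ()) (λ ()) (λ ())) μ02) μ01
    μ20 : μ 2F 0F ≈ 0#
    μ20 = left-zero ≈-refl (triple refl {2F} {0F} {1F} (λ ()) (λ ()) (λ ()))
      (+-zero μ21 (left-zero ≈-refl (right-zero ≈-refl μ12+μ20 μ12) μ02))
  determined {suc (suc (suc (suc m)))} μ rel (inner , top , second , left) = entry
    where
    open Relations rel
    inner′ : ∀ i j → μ (suc (suc i)) (suc (suc j)) ≈ 0#
    inner′ i j with i ≟ j
    ... | yes refl = diagonal _
    ... | no i≢j = inner i j i≢j
    -- Row 0 is zero; row 1 and the rows from 3 on have sum 0 because their columns do; `total` then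
    -- settles row 2. After that the entries in column 0 below row 1, then (1 , 2), then (1 , 0),
    -- are each the only unknown in a row or column of sum 0.
    row₀ : sum (μ 0F) ≈ 0#
    row₀ = sum-zero (μ 0F) λ { 0F → diagonal 0F ; (suc j) → top j }
    col₁ : sum (λ i → μ i 1F) ≈ 0#
    col₁ = sum-zero (λ i → μ i 1F) λ { 0F → top 0F ; 1F → diagonal 1F ; (suc (suc i)) → left i }
    row₁ : sum (μ 1F) ≈ 0#
    row₁ = col⇒row 1F col₁
    row₃ : ∀ i → sum (μ (suc (suc (suc i)))) ≈ 0#
    row₃ i = col⇒row _ (sum-zero (λ j → μ j (suc (suc (suc i)))) λ { 0F → top _ ; 1F →
        second i ; (suc (suc j)) → inner′ j (suc i) })
    row₂ : sum (μ 2F) ≈ 0#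
    row₂ = ≈-trans (≈-sym (sum-single (λ i → sum (μ i)) 2F λ where
        0F _ → row₀
        1F _ → row₁
        2F 2≢2 → contradiction refl 2≢2
        (suc (suc (suc i))) _ → row₃ i)) total
    lower : ∀ i → μ (suc (suc i)) 0F ≈ 0#
    lower i = ≈-trans (≈-sym (sum-single (μ (suc (suc i))) 0F λ where
        0F 0≢0 → contradiction refl 0≢0
        1F _ → left i
        (suc (suc j)) _ → inner′ i j)) (rows i)
      where
      rows : ∀ i → sum (μ (suc (suc i))) ≈ 0#
      rows 0F = row₂
      rows (suc i) = row₃ i
    μ12 : μ 1F 2F ≈ 0#
    μ12 = ≈-trans (≈-sym (sum-single (λ i → μ i 2F) 1F λ where
        0F _ → top 1F
        1F 1≢1 → contradiction refl 1≢1
        (suc (suc i)) _ → inner′ i 0F)) (row⇒col 2F row₂)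
    right : ∀ j → μ 1F (suc j) ≈ 0#
    right 0F = diagonal 1F
    right 1F = μ12
    right (suc (suc j)) = second j
    μ10 : μ 1F 0F ≈ 0#
    μ10 = ≈-trans (≈-sym (sum-single (μ 1F) 0F λ where
        0F 0≢0 → contradiction refl 0≢0
        (suc j) _ → right j)) row₁
    entry : ∀ i j → i ≢ j → μ i j ≈ 0#
    entry 0F 0F i≢j = contradiction refl i≢j
    entry 0F (suc j) _ = top j
    entry 1F 0F _ = μ10
    entry 1F (suc j) _ = right j
    entry (suc (suc i)) 0F _ = lower i
    entry (suc (suc i)) 1F _ = left i
    entry (suc (suc i)) (suc (suc j)) _ = inner′ i j

  ⟨_⟩ : ∀ {P : Set ℓp} → Dec P → Carrier
  ⟨ P? ⟩ = if does P? then 1# else 0#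

  ⟨⟩-yes : ∀ {P : Set ℓp} (P? : Dec P) → P → ⟨ P? ⟩ ≈ 1#
  ⟨⟩-yes P? P rewrite dec-true P? P = ≈-refl

  ⟨⟩-no : ∀ {P : Set ℓp} (P? : Dec P) → ¬ P → ⟨ P? ⟩ ≈ 0#
  ⟨⟩-no P? ¬P rewrite dec-false P? ¬P = ≈-refl

  ⟨⟩-cong : ∀ {P : Set ℓp} {Q : Set ℓq} (P? : Dec P) (Q? : Dec Q) → (P → Q) →
      (Q → P) → ⟨ P? ⟩ ≈ ⟨ Q? ⟩
  ⟨⟩-cong P? (yes Q) P→Q Q→P = ⟨⟩-yes P? (Q→P Q)
  ⟨⟩-cong P? (no ¬Q) P→Q Q→P = ⟨⟩-no P? (¬Q ∘ P→Q)

  ⟨⟩-split : ∀ {P : Set ℓp} {Q : Set ℓq} {R : Set ℓr} (P? : Dec P) (Q? : Dec Q) (R? : Dec R) →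
             (P → Q ⊎ R) → (Q → P) → (R → P) → (Q → ¬ R) → ⟨ P? ⟩ ≈ ⟨ Q? ⟩ + ⟨ R? ⟩
  ⟨⟩-split P? (yes Q) R? split left right excl =
    ≈-trans (⟨⟩-yes P? (left Q)) (≈-sym (≈-trans (+-congˡ (⟨⟩-no R? (excl Q))) (+-identityʳ 1#)))
  ⟨⟩-split P? (no ¬Q) R? split left right excl = ≈-trans
    (⟨⟩-cong P? R? (λ P → [ (λ Q → contradiction Q ¬Q) , id ]′ (split P)) right)
        (≈-sym (+-identityˡ _))

  ⟨⟩-sum : ∀ {k} {P : Set ℓp} {Q : Fin k → Set ℓq} (P? : Dec P) (Q? : ∀ i → Dec (Q i)) →
           (P → ∃[ i ] Q i) → (∀ i → Q i → P) → (∀ i j → Q i → Q j → i ≡ j) →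
           ⟨ P? ⟩ ≈ sum (λ i → ⟨ Q? i ⟩)
  ⟨⟩-sum {k = zero} P? Q? to from unique = ⟨⟩-no P? λ P → case (to P) of λ ()
  ⟨⟩-sum {k = suc k} P? Q? to from unique = ≈-trans
    (⟨⟩-split P? (Q? zero) (any? (Q? ∘ suc))
      (λ P → cases (to P)) (from zero) (λ (i , Qi) → from (suc i) Qi)
      (λ Q₀ (i , Qi) → 0≢1+n (unique zero (suc i) Q₀ Qi)))
    (+-congˡ (⟨⟩-sum (any? (Q? ∘ suc)) (Q? ∘ suc) id (λ i Qi → i , Qi)
      (λ i j Qi Qj → suc-injective (unique (suc i) (suc j) Qi Qj))))
    where
    cases : ∀ {Q : Fin (suc k) → Set ℓq} → ∃[ i ] Q i → Q zero ⊎ (∃[ i ] Q (suc i))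
    cases (zero , Q₀) = inj₁ Q₀
    cases (suc i , Qi) = inj₂ (i , Qi)

ι-surjective : ∀ (B : Subset n) {x} → x ∈ B → ∃[ i ] Realisation.ι B i ≡ x
ι-surjective B x∈B = Any.index (∈-elems x∈B) , sym (lookup-index (∈-elems x∈B))

ι-∈ : ∀ (B : Subset n) i → Realisation.ι B i ∈ B
ι-∈ B i = All.lookup (elems-⊆ B) (∈-lookup i)

-- A fourth distinct element would give an injection of `Fin 4` into `Fin 3`.
exhaust₃ : ∀ {k} → k ≡ 3 → {i j l : Fin k} → i ≢ j → i ≢ l → j ≢ l → ∀ x → x ≡ i ⊎ x ≡ j ⊎ x ≡ l
exhaust₃ refl {i} {j} {l} i≢j i≢l j≢l x with x ≟ i | x ≟ j | x ≟ l
... | yes x≡i | _ | _ = inj₁ x≡i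
... | no _ | yes x≡j | _ = inj₂ (inj₁ x≡j)
... | no _ | no _ | yes x≡l = inj₂ (inj₂ x≡l)
... | no x≢i | no x≢j | no x≢l = contradiction
  (injective⇒≤ {f = lookup (x ∷ i ∷ j ∷ l ∷ [])} λ {p} {q} →
    lookup-injective ((x≢i ∷ x≢j ∷ x≢l ∷ []) ∷ (i≢j ∷ i≢l ∷ []) ∷ (j≢l ∷ []) ∷ [] ∷ []) p q) ℕ.1+n≰n

-- Additive functionals on functions of a ranking

module Functionals {c ℓ₁ ℓ₂ ℓ₃} (ℝ : Reals c ℓ₁ ℓ₂ ℓ₃) {n : ℕ} where

  open Real ℝ
  open Order

  -- The coordinates of u, extended to an additive functional E on all
  -- functions of a ranking: for u = Σ w_π v_π, E f = Σ w_π f π.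
  record Extension (s : Carrier) (u : Point ℝ (Θ n)) : Set (c ⊔ ℓ₁) where
    field
      E        : (Ranking n → Carrier) → Carrier
      E-cong   : ∀ {f g} → (∀ π → f π ≈ g π) → E f ≈ E g
      E-+      : ∀ f g → E (λ π → f π + g π) ≈ E f + E g
      E-1      : E (λ _ → 1#) ≈ s
      E-vertex : ∀ θ → E (λ π → vertex ℝ π θ) ≈ u θ

  module Annihilated {u} (X : Extension 0# u) where
    open Extension X

    E-0 : E (λ _ → 0#) ≈ 0#
    E-0 = x+x≈x⇒x≈0 _ (≈-trans (≈-sym (E-+ _ _)) (E-cong λ _ → +-identityˡ 0#))

    E-sum : ∀ {k} (f : Fin k → Ranking n → Carrier) →
            E (λ π → sum (λ i → f i π)) ≈ sum (λ i → E (f i))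
    E-sum {zero} f = E-0
    E-sum {suc k} f = ≈-trans (E-+ _ _) (+-congˡ (E-sum (f ∘ suc)))

    -- Extends the coordinates of `u` to all `a`, `b` and `B`, so that full rows and columns can be
    -- summed and singletons need no exception. On `Θ n` it agrees with `u` by `E-vertex`.
    coord : Subset n → Fin n → Fin n → Carrier
    coord B a b = E (λ π → ⟨ bw? π B a b ⟩)

    Zero : Subset n → Set ℓ₁
    Zero B = ∀ {a b} → a ∈ B → b ∈ B → a ≢ b → coord B a b ≈ 0#

    module _ (B : Subset n) where
      open Realisation B using (k; ι; ι-injective)

      E-best : ∀ a → E (λ π → ⟨ best? π B a ⟩) ≈ sum (λ j → coord B a (ι j))
      E-best a = ≈-trans (E-cong λ π → ⟨⟩-sum (best? π B a) (λ j → bw? π B a (ι j))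
          (λ best → let b , worst = worst-exists π B (proj₁ (best⁻ π B best))
                        j , ιj≡b = ι-surjective B (proj₁ (worst⁻ π B worst))
                    in  j , best , subst (Worst π B) (sym ιj≡b) worst)
          (λ _ → proj₁)
          (λ i j p q → ι-injective (worst-unique π B (proj₂ p) (proj₂ q))))
        (E-sum λ j π → ⟨ bw? π B a (ι j) ⟩)

      E-worst : ∀ b → E (λ π → ⟨ worst? π B b ⟩) ≈ sum (λ i → coord B (ι i) b)
      E-worst b = ≈-trans (E-cong λ π → ⟨⟩-sum (worst? π B b) (λ i → bw? π B (ι i) b)
          (λ worst → let a , best = best-exists π B (proj₁ (worst⁻ π B worst))
                         i , ιi≡a = ι-surjective B (proj₁ (best⁻ π B best))
                     in  i , subst (Best π B) (sym ιi≡a) best , worst)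
          (λ _ → proj₂)
          (λ i j p q → ι-injective (best-unique π B (proj₁ p) (proj₁ q))))
        (E-sum λ i π → ⟨ bw? π B (ι i) b ⟩)

      -- Every ranking has exactly one best element of `B`, so the events add up to the constant 1,
      -- which `E` sends to 0.
      E-total : ∀ {x} → x ∈ B → sum (λ i → sum (λ j → coord B (ι i) (ι j))) ≈ 0#
      E-total x∈B = ≈-trans (≈-sym (sum-cong-≋ λ i → E-best (ι i)))
        (≈-trans (≈-sym (E-sum λ i π → ⟨ best? π B (ι i) ⟩))
        (≈-trans (E-cong λ π →
            ≈-sym (≈-trans (≈-sym (⟨⟩-yes (yes tt) tt)) (⟨⟩-sum (yes tt) (λ i → best? π B (ι i))
            (λ _ → let a , best = best-exists π B x∈B
                       i , ιi≡a = ι-surjective B (proj₁ (best⁻ π B best))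
                   in  i , subst (Best π B) (sym ιi≡a) best)
            (λ _ _ → tt)
            (λ i j p q → ι-injective (best-unique π B p q)))))
          E-1))

      E-diagonal : ∀ {x y} a → x ∈ B → y ∈ B → x ≢ y → coord B a a ≈ 0#
      E-diagonal a x∈B y∈B x≢y = ≈-trans
        (E-cong λ π → ⟨⟩-no (bw? π B a a) λ (best , worst) → best≢worst π B x∈B y∈B x≢y best worst)
            E-0

      -- If `B` has only the element `a`, the event is certain and `E-1` gives 0. Otherwise it
      -- decomposes into column `a`, whose diagonal entry vanishes because `B` has a second element.
      worst-zero : Zero B → ∀ {a} → a ∈ B → E (λ π → ⟨ worst? π B a ⟩) ≈ 0#
      worst-zero zeroB {a} a∈B with All.all? (a ≟_) (elems B)
      ... | yes a≡ = ≈-trans (E-cong λ π → ⟨⟩-yes (worst? π B a) (worst⁺ π B a∈B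
              λ x∈B x≢a → contradiction (sym (All.lookup a≡ (∈-elems x∈B))) x≢a)) E-1
      ... | no ¬a≡ = ≈-trans (E-worst a) (sum-zero _ zero′)
        where
        other : ∃[ x ] x ∈ₗ elems B × a ≢ x
        other = find (All.¬All⇒Any¬ (a ≟_) (elems B) ¬a≡)
        zero′ : ∀ i → coord B (ι i) a ≈ 0#
        zero′ i with ι i ≟ a
        ... | no ιi≢a = zeroB (ι-∈ B i) a∈B ιi≢a
        ... | yes refl = E-diagonal (ι i) a∈B (All.lookup (elems-⊆ B) (proj₁ (proj₂ other)))
            (proj₂ (proj₂ other))

    module _ (B : Subset n) (smaller : ∀ {C} → C ⊂ B → Zero C) where

      E-worstBefore : Fin n → Subset n → List (Fin n) → Carrier
      E-worstBefore a C Q = E (λ π → ⟨ worstBefore? π a C Q ⟩)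

      E-worstBefore-split : ∀ {a C q} Q → a ∈ C → q ∉ C →
        E-worstBefore a C Q ≈ E-worstBefore a C (q ∷ Q) + E-worstBefore a (C ∪ ⁅ q ⁆) Q
      E-worstBefore-split {a} {C} {q} Q a∈C q∉C = ≈-trans
        (E-cong λ π → ⟨⟩-split (worstBefore? π a C Q) (worstBefore? π a C (q ∷ Q))
            (worstBefore? π a (C ∪ ⁅ q ⁆) Q)
          (worstBefore-split π a∈C q∉C) (worstBefore-tail π a∈C q∉C) (worstBefore-shrink π a∈C q∉C)
              (worstBefore-exclusive π a∈C q∉C))
        (E-+ _ _)

      E-worstBefore-[] : ∀ a C → E-worstBefore a C [] ≈ E (λ π → ⟨ worst? π C a ⟩)
      E-worstBefore-[] a C = E-cong λ π → ⟨⟩-cong (worstBefore? π a C []) (worst? π C a) proj₁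
          (_, [])

      ∪-⊆ : ∀ {C : Subset n} {q} → C ⊆ B → q ∈ B → C ∪ ⁅ q ⁆ ⊆ B
      ∪-⊆ {C} {q} C⊆B q∈B x∈ = [ C⊆B , (λ x∈q → subst (_∈ B) (sym (x∈⁅y⁆⇒x≡y q x∈q)) q∈B) ]′
          (x∈p∪q⁻ C ⁅ q ⁆ x∈)

      ∪-∉ : ∀ {C : Subset n} {q x} → x ∉ C → q ≢ x → x ∉ C ∪ ⁅ q ⁆
      ∪-∉ {C} {q} x∉C q≢x x∈ = [ x∉C , (λ x∈q → q≢x (sym (x∈⁅y⁆⇒x≡y q x∈q))) ]′ (x∈p∪q⁻ C ⁅ q ⁆ x∈)

      -- Splitting off the elements of `Q` one by one only reaches sets that miss `z`. These are
      -- proper subsets of `B`, where the worst-element events vanish.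
      proper : ∀ {a z} C Q → a ∈ C → C ⊆ B → All (_∈ B) Q → Unique Q → All (_∉ C) Q →
               z ∈ B → z ∉ C → All (_≢ z) Q → E-worstBefore a C Q ≈ 0#
      proper {a} {z} C [] a∈C C⊆B _ _ _ z∈B z∉C _ =
        ≈-trans (E-worstBefore-[] a C) (worst-zero C (smaller (C⊆B , z , z∈B , z∉C)) a∈C)
      proper {a} C (q ∷ Q) a∈C C⊆B (q∈B ∷ Q∈B) (q∉Q ∷ Q!) (q∉C ∷ Q∉C) z∈B z∉C (q≢z ∷ Q≢z) =
        left-zero (E-worstBefore-split Q a∈C q∉C)
          (proper C Q a∈C C⊆B Q∈B Q! Q∉C z∈B z∉C Q≢z)
          (proper (C ∪ ⁅ q ⁆) Q (x∈p∪q⁺ (inj₁ a∈C)) (∪-⊆ C⊆B q∈B) Q∈B Q!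
            (All.zipWith (λ (x∉C , q≢x) → ∪-∉ x∉C q≢x) (Q∉C , q∉Q)) z∈B (∪-∉ z∉C q≢z) Q≢z)

      Equizero : Carrier → Carrier → Set ℓ₁
      Equizero x y = (x ≈ 0# → y ≈ 0#) × (y ≈ 0# → x ≈ 0#)

      -- Each element of Q in turn moves from below a to above a; only the sign changes.
      transfer : ∀ {a} C Q → a ∈ C → C ⊆ B → All (_∈ B) Q → Unique Q → All (_∉ C) Q →
                 (∀ {x} → x ∈ B → x ∈ C ⊎ x ∈ₗ Q) →
                 Equizero (E-worstBefore a C Q) (E (λ π → ⟨ worst? π B a ⟩))
      transfer {a} C [] a∈C C⊆B _ _ _ cover
        with refl ← ⊆-antisym C⊆B (λ {x} x∈B → [ id , (λ ()) ]′ (cover x∈B)) =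
        (λ e → ≈-trans (≈-sym (E-worstBefore-[] a C)) e) , (λ e → ≈-trans (E-worstBefore-[] a C) e)
      transfer {a} C (q ∷ Q) a∈C C⊆B (q∈B ∷ Q∈B) (q∉Q ∷ Q!) (q∉C ∷ Q∉C) cover =
        (λ e → to (right-zero split zeroC e)) , (λ e → left-zero split zeroC (from e))
        where
        split = E-worstBefore-split Q a∈C q∉C
        -- The moved element `q` is itself the element of `B` missing from `C` and `Q`, so the
        -- undivided event vanishes and the two parts are negatives of each other.
        zeroC = proper C Q a∈C C⊆B Q∈B Q! Q∉C q∈B q∉C (All.map (λ q≢x x≡q → q≢x (sym x≡q)) q∉Q)
        cover′ : ∀ {x} → x ∈ B → x ∈ C ∪ ⁅ q ⁆ ⊎ x ∈ₗ Q
        cover′ x∈B = [ (λ x∈C → inj₁ (x∈p∪q⁺ (inj₁ x∈C))) ,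
          (λ { (here refl) → inj₁ (x∈p∪q⁺ {p = C} (inj₂ (x∈⁅x⁆ q))) ; (there x∈Q) → inj₂ x∈Q }) ]′
              (cover x∈B)
        rest = transfer (C ∪ ⁅ q ⁆) Q (x∈p∪q⁺ (inj₁ a∈C)) (∪-⊆ C⊆B q∈B) Q∈B Q!
          (All.zipWith (λ (x∉C , q≢x) → ∪-∉ x∉C q≢x) (Q∉C , q∉Q)) cover′
        to = proj₁ rest
        from = proj₂ rest

      best-worst : ∀ {a} → a ∈ B → Equizero (E (λ π → ⟨ best? π B a ⟩)) (E (λ π → ⟨ worst? π B a ⟩))
      best-worst {a} a∈B =
          (λ e → proj₁ rest (≈-trans eq e)) , (λ e → ≈-trans (≈-sym eq) (proj₂ rest e))
        where
        Q = filter (¬? ∘ (_≟ a)) (elems B)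
        Q⊆B : All (_∈ B) Q
        Q⊆B = All.filter⁺ (¬? ∘ (_≟ a)) (elems-⊆ B)
        Q≢a : All (_≢ a) Q
        Q≢a = All.all-filter (¬? ∘ (_≟ a)) (elems B)
        ∈Q : ∀ {x} → x ∈ B → x ≢ a → x ∈ₗ Q
        ∈Q x∈B x≢a = ∈-filter⁺ (¬? ∘ (_≟ a)) (∈-elems x∈B) x≢a
        cover : ∀ {x} → x ∈ B → x ∈ ⁅ a ⁆ ⊎ x ∈ₗ Q
        cover {x} x∈B with x ≟ a
        ... | yes refl = inj₁ (x∈⁅x⁆ x)
        ... | no x≢a = inj₂ (∈Q x∈B x≢a)
        rest = transfer ⁅ a ⁆ Q (x∈⁅x⁆ a) (λ x∈ → subst (_∈ B) (sym (x∈⁅y⁆⇒x≡y a x∈)) a∈B)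
          Q⊆B (Unique.filter⁺ (¬? ∘ (_≟ a)) (elems-unique B))
              (All.map (λ x≢a x∈ → x≢a (x∈⁅y⁆⇒x≡y a x∈)) Q≢a) cover
        eq : E-worstBefore a ⁅ a ⁆ Q ≈ E (λ π → ⟨ best? π B a ⟩)
        eq = E-cong λ π → ⟨⟩-cong (worstBefore? π a ⁅ a ⁆ Q) (best? π B a)
          (λ (_ , a≺Q) → best⁺ π B a∈B λ x∈B x≢a → All.lookup a≺Q (∈Q x∈B x≢a))
          (λ best → worst⁺ π ⁅ a ⁆ (x∈⁅x⁆ a) (λ x∈ x≢a → contradiction (x∈⁅y⁆⇒x≡y a x∈) x≢a) ,
            All.zipWith (λ (x∈B , x≢a) → proj₂ (best⁻ π B best) x∈B x≢a) (Q⊆B , Q≢a))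

      open Realisation B using (k; ι; ι-injective)

      -- The event that `a` beats `b` is a coordinate of a two-element proper subset, hence 0; the
      -- third element splits it into three coordinates of `B`.
      triple-relation : k ≡ 3 → ∀ {i j l} → i ≢ j → i ≢ l → j ≢ l →
        coord B (ι i) (ι j) + (coord B (ι i) (ι l) + coord B (ι l) (ι j)) ≈ 0#
      triple-relation k≡3 {i} {j} {l} i≢j i≢l j≢l = ≈-trans (≈-sym (≈-trans
          (E-cong λ π → ≈-trans
            (⟨⟩-split (bw? π C a b) (bw? π B a b) (bw? π B a d ⊎-dec bw? π B d b)
              (triple-split π a∈ b∈ d∈ only a≢b a≢d b≢d)
              (triple-join₁ π a∈ b∈ d∈ only a≢b a≢d b≢d)
              (triple-join₂ π a∈ b∈ d∈ only a≢b a≢d b≢d)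
              λ (best , worst) → [ (λ (_ , worst′) → b≢d (worst-unique π B worst worst′)) ,
                                   (λ (best′ , _) → a≢d (best-unique π B best best′)) ]′)
            (+-congˡ (⟨⟩-split (bw? π B a d ⊎-dec bw? π B d b) (bw? π B a d)
                (bw? π B d b) id inj₁ inj₂
              λ (best , _) (best′ , _) → a≢d (best-unique π B best best′))))
          (≈-trans (E-+ _ _) (+-congˡ (E-+ _ _)))))
        (smaller (C⊆B , d , d∈ , d∉C) (x∈p∪q⁺ (inj₁ (x∈⁅x⁆ a)))
            (x∈p∪q⁺ {p = ⁅ a ⁆} (inj₂ (x∈⁅x⁆ b))) a≢b)
        where
        a = ι i
        b = ι j
        d = ι l
        C = ⁅ a ⁆ ∪ ⁅ b ⁆
        a∈ = ι-∈ B i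
        b∈ = ι-∈ B j
        d∈ = ι-∈ B l
        a≢b : a ≢ b
        a≢b = i≢j ∘ ι-injective
        a≢d : a ≢ d
        a≢d = i≢l ∘ ι-injective
        b≢d : b ≢ d
        b≢d = j≢l ∘ ι-injective
        only : ∀ {x} → x ∈ B → x ≡ a ⊎ x ≡ b ⊎ x ≡ d
        only x∈B with x , refl ← ι-surjective B x∈B =
          Sum.map (cong ι) (Sum.map (cong ι) (cong ι)) (exhaust₃ k≡3 i≢j i≢l j≢l x)
        C⊆B : C ⊆ B
        C⊆B x∈ = [ (λ x∈a → subst (_∈ B) (sym (x∈⁅y⁆⇒x≡y a x∈a)) a∈) ,
                   (λ x∈b → subst (_∈ B) (sym (x∈⁅y⁆⇒x≡y b x∈b)) b∈) ]′ (x∈p∪q⁻ ⁅ a ⁆ ⁅ b ⁆ x∈)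
        d∉C : d ∉ C
        d∉C d∈C = [ (λ d∈a → a≢d (sym (x∈⁅y⁆⇒x≡y a d∈a))) ,
                    (λ d∈b → b≢d (sym (x∈⁅y⁆⇒x≡y b d∈b))) ]′ (x∈p∪q⁻ ⁅ a ⁆ ⁅ b ⁆ d∈C)

      relations : ∀ {x y} → x ∈ B → y ∈ B → x ≢ y → Relations (λ i j → coord B (ι i) (ι j))
      relations x∈B y∈B x≢y = record
        { diagonal = λ i → E-diagonal B (ι i) x∈B y∈B x≢y
        ; col⇒row = λ i e → ≈-trans (≈-sym (E-best B (ι i)))
            (proj₂ (best-worst (ι-∈ B i)) (≈-trans (E-worst B (ι i)) e))
        ; row⇒col = λ i e → ≈-trans (≈-sym (E-worst B (ι i)))
            (proj₁ (best-worst (ι-∈ B i)) (≈-trans (E-best B (ι i)) e))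
        ; total = E-total B x∈B
        ; triple = triple-relation
        }

      zero-from-covered : Covered k (λ i j → coord B (ι i) (ι j) ≈ 0#) → Zero B
      zero-from-covered covered x∈B y∈B x≢y
        with i , refl ← ι-surjective B x∈B | j , refl ← ι-surjective B y∈B =
        determined _ (relations x∈B y∈B x≢y) covered i j (x≢y ∘ cong ι)

-- Triangular bases

module LinearAlgebra {c ℓ₁ ℓ₂ ℓ₃} (ℝ : Reals c ℓ₁ ℓ₂ ℓ₃) {i} (I : Set i) where

  open Real ℝ
  open SetoidReasoning setoid

  private
    V = Point ℝ I
    Pivots = List (I × V)
    basis : (ps : Pivots) → Vector.Vector V (length ps)
    basis ps j = proj₂ (lookup ps j)

  Triangular : Pivots → Set (c ⊔ ℓ₁ ⊔ i)
  Triangular = AllPairs (λ p q → proj₂ q (proj₁ p) ≈ 0#)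

  Unital : Pivots → Set (c ⊔ ℓ₁ ⊔ i)
  Unital = All (λ p → proj₂ p (proj₁ p) ≈ 1#)

  lincomb-zero : ∀ t ps (w : Vector.Vector Carrier (length ps)) → All (λ q → proj₂ q t ≈ 0#) ps →
                 lincomb ℝ I w (basis ps) t ≈ 0#
  lincomb-zero t ps w zs = sum-zero _ λ j → ≈-trans (*-congˡ (All.lookup zs (∈-lookup j)))
      (zeroʳ (w j))

  -- At the coordinate of the first pivot all later vectors vanish, so that coordinate of the
  -- combination is the first coefficient.
  independent : ∀ ps → Unital ps → Triangular ps → LinearlyIndependent ℝ I (basis ps)
  independent [] _ _ w _ ()
  independent ((t , e) ∷ ps) (unit ∷ units) (before ∷ tri) w eq = all
    where
    w₀ : w zero ≈ 0#
    w₀ = begin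
      w zero           ≈⟨ *-identityʳ (w zero) ⟨
      w zero * 1#      ≈⟨ *-congˡ unit ⟨
      w zero * e t     ≈⟨ drop-right ≈-refl (lincomb-zero t ps (w ∘ suc) before) ⟨
      lincomb ℝ I w (basis ((t , e) ∷ ps)) t ≈⟨ eq t ⟩
      0#               ∎
    all : ∀ j → w j ≈ 0#
    all zero = w₀
    all (suc j) = independent ps units tri (w ∘ suc)
      (λ t′ → right-zero ≈-refl (eq t′) (≈-trans (*-congʳ w₀) (zeroˡ _))) j

  -- Gaussian elimination: subtract the multiple of `e` that clears coordinate `t` and continue in
  -- the subspace `Q₀` of vectors vanishing at `t`. Triangularity places the remaining pivots in
  -- `Q₀`; when none is left, `separated` shows that nothing remains.
  spanning : ∀ {ℓ} (Q : Pred V ℓ) →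
             (∀ {u e} r → Q u → Q e → Q (λ t → u t - r * e t)) →
             ∀ ps → All (Q ∘ proj₂) ps → Unital ps → Triangular ps →
             (∀ u → Q u → All (λ p → u (proj₁ p) ≈ 0#) ps → ∀ t → u t ≈ 0#) →
             ∀ u → Q u → ∃[ w ] _≋_ ℝ I u (lincomb ℝ I w (basis ps))
  spanning Q closed [] _ _ _ separated u Qu = (λ ()) , separated u Qu []
  spanning Q closed ((t , e) ∷ ps) (Qe ∷ Qps) (unit ∷ units) (before ∷ tri) separated u Qu =
    let w , u′≈ = spanning Q₀ closed₀ ps (All.zip (Qps , before)) units tri
                    (λ v (Qv , vt≈0) zs → separated v Qv (vt≈0 ∷ zs))
                    (λ t′ → u t′ - u t * e t′) (closed (u t) Qu Qe , u′t≈0)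
    in  (u t Vector.∷ w) , λ t′ → restore (u′≈ t′)
    where
    Q₀ : Pred V _
    Q₀ v = Q v × v t ≈ 0#
    minus-zero : ∀ {x y} r → x ≈ 0# → y ≈ 0# → x - r * y ≈ 0#
    minus-zero r x≈0 y≈0 = +-zero x≈0 (≈-trans (-‿cong (≈-trans (*-congˡ y≈0) (zeroʳ r))) -0#≈0#)
    closed₀ : ∀ {v e} r → Q₀ v → Q₀ e → Q₀ (λ t → v t - r * e t)
    closed₀ r (Qv , v≈0) (Qe , e≈0) = closed r Qv Qe , minus-zero r v≈0 e≈0
    u′t≈0 : u t - u t * e t ≈ 0#
    u′t≈0 = ≈-trans (+-congˡ (-‿cong (≈-trans (*-congˡ unit) (*-identityʳ (u t)))))
        (-‿inverseʳ (u t))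
    restore : ∀ {x y z} → x - y ≈ z → x ≈ y + z
    restore {x} {y} {z} eq = begin
      x              ≈⟨ +-identityʳ x ⟨
      x + 0#         ≈⟨ +-congˡ (-‿inverseˡ y) ⟨
      x + (- y + y)  ≈⟨ +-assoc x (- y) y ⟨
      x - y + y      ≈⟨ +-congʳ eq ⟩
      z + y          ≈⟨ +-comm z y ⟩
      y + z          ∎

-- The direction space of the polytope

module Directions {c ℓ₁ ℓ₂ ℓ₃} (ℝ : Reals c ℓ₁ ℓ₂ ℓ₃) {n : ℕ} where

  open Real ℝ
  open Functionals ℝ {n}
  open Extension
  open SetoidReasoning setoid
  open SemiringSum semiring using (∑-distrib-+; *-distribˡ-sum)
  open CommutativeSemigroupProperties +-commutativeSemigroup using (interchange)

  private
    Space = Point ℝ (Θ n)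
    _≋ᵥ_ = _≋_ ℝ (Θ n)

  isVertex : Pred Space ℓ₁
  isVertex x = ∃[ π ] x ≋ᵥ vertex ℝ π

  ext-cong : ∀ {s s′ u u′} → s ≈ s′ → u ≋ᵥ u′ → Extension s u → Extension s′ u′
  ext-cong s≈s′ u≋u′ X = record
    { E = E X ; E-cong = E-cong X ; E-+ = E-+ X ; E-1 = ≈-trans (E-1 X) s≈s′
    ; E-vertex = λ θ → ≈-trans (E-vertex X θ) (u≋u′ θ) }

  ext-vertex : ∀ π → Extension 1# (vertex ℝ π)
  ext-vertex π = record
    { E = λ f → f π ; E-cong = λ f≈g → f≈g π ; E-+ = λ _ _ → ≈-refl ; E-1 = ≈-refl ; E-vertex =
        λ _ → ≈-refl }

  ext-lincomb : ∀ {k} (w : Vector.Vector Carrier k) (p : Vector.Vector Space k) →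
                (∀ j → Extension 1# (p j)) → Extension (sum w) (lincomb ℝ (Θ n) w p)
  ext-lincomb w p X = record
    { E = λ f → sum (λ j → w j * E (X j) f)
    ; E-cong = λ f≈g → sum-cong-≋ λ j → *-congˡ (E-cong (X j) f≈g)
    ; E-+ = λ f g →
        ≈-trans (sum-cong-≋ λ j → ≈-trans (*-congˡ (E-+ (X j) f g)) (distribˡ (w j) _ _))
        (∑-distrib-+ (λ j → w j * E (X j) f) (λ j → w j * E (X j) g))
    ; E-1 = sum-cong-≋ λ j → ≈-trans (*-congˡ (E-1 (X j))) (*-identityʳ (w j))
    ; E-vertex = λ θ → sum-cong-≋ λ j → *-congˡ (E-vertex (X j) θ) }

  ext-minus : ∀ {s t u v} r → Extension s u → Extension t v →
      Extension (s - r * t) (λ θ → u θ - r * v θ)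
  ext-minus r X Y = record
    { E = λ f → E X f - r * E Y f
    ; E-cong = λ f≈g → +-cong (E-cong X f≈g) (-‿cong (*-congˡ (E-cong Y f≈g)))
    ; E-+ = λ f g → begin
        E X (λ π → f π + g π) - r * E Y (λ π → f π + g π)      ≈⟨ +-cong (E-+ X f g)
            (-‿cong (≈-trans (*-congˡ (E-+ Y f g)) (distribˡ r _ _))) ⟩
        E X f + E X g - (r * E Y f + r * E Y g)                ≈⟨ +-congˡ (-‿+-comm _ _) ⟨
        E X f + E X g + (- (r * E Y f) + - (r * E Y g))        ≈⟨ interchange _ _ _ _ ⟩
        (E X f - r * E Y f) + (E X g - r * E Y g)              ∎
    ; E-1 = +-cong (E-1 X) (-‿cong (*-congˡ (E-1 Y)))
    ; E-vertex = λ θ → +-cong (E-vertex X θ) (-‿cong (*-congˡ (E-vertex Y θ))) }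

  ext-conv : ∀ {x} → conv ℝ (Θ n) isVertex x → Extension 1# x
  ext-conv (_ , w , p , vs , _ , w≈1 , x≋) = ext-cong w≈1 (λ θ → ≈-sym (x≋ θ))
    (ext-lincomb w p λ j → let π , pj≋ = vs j in ext-cong ≈-refl (λ θ → ≈-sym (pj≋ θ)) (ext-vertex π))

  ext-aff : ∀ {x} → aff ℝ (Θ n) (BW ℝ n) x → Extension 1# x
  ext-aff (_ , w , p , cs , w≈1 , x≋) = ext-cong w≈1 (λ θ → ≈-sym (x≋ θ))
      (ext-lincomb w p (ext-conv ∘ cs))

  ext-direction : ∀ {u} → direction ℝ (Θ n) (aff ℝ (Θ n) (BW ℝ n)) u → Extension 0# u
  ext-direction (x , y , affx , affy , u≋) = ext-cong
    (≈-trans (+-congˡ (-‿cong (*-identityˡ 1#))) (-‿inverseʳ 1#))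
    (λ θ → ≈-trans (+-congˡ (-‿cong (*-identityˡ (y θ)))) (≈-sym (u≋ θ)))
    (ext-minus 1# (ext-aff affx) (ext-aff affy))

  -- From `1# < 0#` follows `0# < - 1#`, and squaring gives `0# < 1#`. This is the nonnegativity of
  -- the single weight in `vertex∈BW`.
  1≮0 : ¬ (Reals._<_ ℝ 1# 0#)
  1≮0 1<0 = asym 1<0 (<-respʳ-≈ square (*-positive 0<-1 0<-1))
    where
    open Reals ℝ using (_<_; isStrictPartialOrder; *-positive; +-monoˡ-<)
    open IsStrictPartialOrder isStrictPartialOrder using (asym; <-respʳ-≈; <-respˡ-≈)
    0<-1 : 0# < - 1#
    0<-1 = <-respʳ-≈ (+-identityˡ (- 1#)) (<-respˡ-≈ (-‿inverseʳ 1#) (+-monoˡ-< (- 1#) 1<0))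
    square : - 1# * - 1# ≈ 1#
    square = begin
      - 1# * - 1#    ≈⟨ -‿distribˡ-* 1# (- 1#) ⟨
      - (1# * - 1#)  ≈⟨ -‿cong (*-identityˡ (- 1#)) ⟩
      - - 1#         ≈⟨ -‿involutive 1# ⟩
      1#             ∎

  vertex∈BW : ∀ π → BW ℝ n (vertex ℝ π)
  vertex∈BW π = 1 , (λ _ → 1#) , (λ _ → vertex ℝ π) , (λ _ → π , λ _ → ≈-refl) , (λ _ → 1≮0)
      , +-identityʳ 1# ,
    λ θ → ≈-sym (≈-trans (+-identityʳ _) (*-identityˡ _))

  vertex∈aff : ∀ π → aff ℝ (Θ n) (BW ℝ n) (vertex ℝ π)
  vertex∈aff π = 1 , (λ _ → 1#) , (λ _ → vertex ℝ π) , (λ _ → vertex∈BW π) , +-identityʳ 1# ,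
    λ θ → ≈-sym (≈-trans (+-identityʳ _) (*-identityˡ _))

  fromℕ : ℕ → Carrier
  fromℕ zero = 0#
  fromℕ (suc m) = 1# + fromℕ m

  fromℤ : ℤ.ℤ → Carrier
  fromℤ (ℤ.+ m) = fromℕ m
  fromℤ ℤ.-[1+ m ] = - fromℕ (suc m)

  fromℕ-+ : ∀ m o → fromℕ (m ℕ.+ o) ≈ fromℕ m + fromℕ o
  fromℕ-+ zero o = ≈-sym (+-identityˡ _)
  fromℕ-+ (suc m) o = ≈-trans (+-congˡ (fromℕ-+ m o)) (≈-sym (+-assoc _ _ _))

  fromℤ-⊖ : ∀ m o → fromℤ (m ℤ.⊖ o) ≈ fromℕ m - fromℕ o
  fromℤ-⊖ zero zero = ≈-sym (-‿inverseʳ 0#)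
  fromℤ-⊖ zero (suc o) = ≈-sym (+-identityˡ _)
  fromℤ-⊖ (suc m) zero = ≈-sym (≈-trans (+-congˡ -0#≈0#) (+-identityʳ _))
  fromℤ-⊖ (suc m) (suc o) = begin
    fromℤ (suc m ℤ.⊖ suc o)              ≡⟨ cong fromℤ (ℤ.[1+m]⊖[1+n]≡m⊖n m o) ⟩
    fromℤ (m ℤ.⊖ o)                      ≈⟨ fromℤ-⊖ m o ⟩
    fromℕ m - fromℕ o                    ≈⟨ +-identityˡ _ ⟨
    0# + (fromℕ m - fromℕ o)             ≈⟨ +-congʳ (-‿inverseʳ 1#) ⟨
    (1# - 1#) + (fromℕ m - fromℕ o)      ≈⟨ interchange _ _ _ _ ⟩
    (1# + fromℕ m) + (- 1# - fromℕ o)    ≈⟨ +-congˡ (-‿+-comm 1# (fromℕ o)) ⟩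
    (1# + fromℕ m) - (1# + fromℕ o)      ∎

  fromℤ-+ : ∀ x y → fromℤ (x ℤ.+ y) ≈ fromℤ x + fromℤ y
  fromℤ-+ (ℤ.+ m) (ℤ.+ o) = fromℕ-+ m o
  fromℤ-+ (ℤ.+ m) ℤ.-[1+ o ] = fromℤ-⊖ m (suc o)
  fromℤ-+ ℤ.-[1+ m ] (ℤ.+ o) = ≈-trans (fromℤ-⊖ o (suc m)) (+-comm _ _)
  fromℤ-+ ℤ.-[1+ m ] ℤ.-[1+ o ] = begin
    - fromℕ (suc (suc (m ℕ.+ o)))          ≈⟨ -‿cong (+-congˡ (fromℕ-+ (suc m) o)) ⟩
    - (1# + (fromℕ (suc m) + fromℕ o))     ≈⟨ -‿cong (x∙yz≈y∙xz 1# (fromℕ (suc m)) (fromℕ o)) ⟩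
    - (fromℕ (suc m) + fromℕ (suc o))      ≈⟨ -‿+-comm _ _ ⟨
    - fromℕ (suc m) + - fromℕ (suc o)      ∎
    where open CommutativeSemigroupProperties +-commutativeSemigroup using (x∙yz≈y∙xz)

  fromℤ-neg : ∀ x → fromℤ (ℤ.- x) ≈ - fromℤ x
  fromℤ-neg (ℤ.+ zero) = ≈-sym -0#≈0#
  fromℤ-neg (ℤ.+ suc m) = ≈-refl
  fromℤ-neg ℤ.-[1+ m ] = ≈-sym (-‿involutive _)

  fromℤ-minus : ∀ x y → fromℤ (x ℤ.- y) ≈ fromℤ x - fromℤ y
  fromℤ-minus x y = ≈-trans (fromℤ-+ x (ℤ.- y)) (+-congˡ (fromℤ-neg y))

  real : Raw n → Space
  real u θ = fromℤ (u (Θ.a θ) (Θ.b θ) (Θ.B θ))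

  Terms : Set c
  Terms = List (Carrier × Ranking n)

  weights : (l : Terms) → Vector.Vector Carrier (length l)
  weights l j = proj₁ (lookup l j)

  vertices : (l : Terms) → Vector.Vector Space (length l)
  vertices l j = vertex ℝ (proj₂ (lookup l j))

  weight : Terms → Carrier
  weight l = sum (weights l)

  value : Terms → Space
  value l = lincomb ℝ (Θ n) (weights l) (vertices l)

  negate : Terms → Terms
  negate = List.map λ (w , π) → - w , π

  weight-minus : ∀ l l′ → weight (l ++ negate l′) ≈ weight l - weight l′
  weight-minus ((w , π) ∷ l) l′ = ≈-trans (+-congˡ (weight-minus l l′)) (≈-sym (+-assoc _ _ _))
  weight-minus [] l′ = ≈-trans (negated l′) (≈-sym (+-identityˡ _))
    where
    negated : ∀ l → weight (negate l) ≈ - weight l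
    negated [] = ≈-sym -0#≈0#
    negated ((w , π) ∷ l) = ≈-trans (+-congˡ (negated l)) (-‿+-comm _ _)

  value-minus : ∀ l l′ θ → value (l ++ negate l′) θ ≈ value l θ - value l′ θ
  value-minus ((w , π) ∷ l) l′ θ = ≈-trans (+-congˡ (value-minus l l′ θ)) (≈-sym (+-assoc _ _ _))
  value-minus [] l′ θ = ≈-trans (negated l′) (≈-sym (+-identityˡ _))
    where
    negated : ∀ l → value (negate l) θ ≈ - value l θ
    negated [] = ≈-sym -0#≈0#
    negated ((w , π) ∷ l) = ≈-trans (+-cong (≈-sym (-‿distribˡ-* w _)) (negated l)) (-‿+-comm _ _)

  terms : ∀ {r u} → Combination r u → ∃[ l ] weight l ≈ fromℤ r × (∀ θ → value l θ ≈ real u θ)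
  terms (vertexOf π) = (1# , π) ∷ [] , ≈-refl , λ θ →
      ≈-trans (≈-trans (+-identityʳ _) (*-identityˡ _)) (indicator-vertex θ)
    where
    indicator-vertex : ∀ θ → vertex ℝ π θ ≈ real (indicator (word π)) θ
    indicator-vertex θ with bw (word π) (Θ.a θ) (Θ.b θ) (Θ.B θ)
    ... | true = ≈-sym (+-identityʳ 1#)
    ... | false = ≈-refl
  terms (minus {r} {s} {u} {v} comb comb′) =
    let l , wl , vl = terms comb ; l′ , wl′ , vl′ = terms comb′ in
    l ++ negate l′ ,
    ≈-trans (weight-minus l l′) (≈-trans (+-cong wl (-‿cong wl′)) (≈-sym (fromℤ-minus r s))) ,
    λ θ → ≈-trans (value-minus l l′ θ) (≈-trans (+-cong (vl θ) (-‿cong (vl′ θ)))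
      (≈-sym (fromℤ-minus (u (Θ.a θ) (Θ.b θ) (Θ.B θ)) (v (Θ.a θ) (Θ.b θ) (Θ.B θ)))))
  terms (respects r≡s u≡v comb) = let l , wl , vl = terms comb in
    l , ≈-trans wl (reflexive (cong fromℤ r≡s)) , λ θ →
        ≈-trans (vl θ) (reflexive (cong fromℤ (u≡v _ _ _)))

  -- Adding one fixed vertex to a combination of coefficient sum 0 gives a point of the affine hull;
  -- its difference from that vertex is the combination.
  combination⇒direction : ∀ {u} → Combination ℤ.0ℤ u → direction ℝ (Θ n) (aff ℝ (Θ n) (BW ℝ n))
      (real u)
  combination⇒direction comb =
    let l , wl , vl = terms comb
        π = Permutation.id
        l′ = (1# , π) ∷ l
    in  value l′ , vertex ℝ π ,
        (_ , weights l′ , vertices l′ , (λ j → vertex∈BW (proj₂ (lookup l′ j))) , ≈-trans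
            (+-congˡ wl) (+-identityʳ 1#) , λ _ → ≈-refl) ,
        vertex∈aff π , λ θ → begin
          _                                             ≈⟨ vl θ ⟨
          value l θ                                     ≈⟨ +-identityʳ _ ⟨
          value l θ + 0#                                ≈⟨ +-congˡ (-‿inverseʳ (vertex ℝ π θ)) ⟨
          value l θ + (vertex ℝ π θ - vertex ℝ π θ)     ≈⟨ +-assoc _ _ _ ⟨
          value l θ + vertex ℝ π θ - vertex ℝ π θ       ≈⟨ +-congʳ (+-comm _ _) ⟩
          vertex ℝ π θ + value l θ - vertex ℝ π θ       ≈⟨ +-congʳ (+-congʳ (*-identityˡ _)) ⟨
          value l′ θ - vertex ℝ π θ                     ∎

-- Summing over subsets

-- In lexicographic order, so that no subset contains a later one.
subsets : ∀ n → List (Subset n)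
subsets zero = Vec.[] ∷ []
subsets (suc n) = map (outside Vec.∷_) (subsets n) ++ map (inside Vec.∷_) (subsets n)

∈-subsets : ∀ {n} (B : Subset n) → B ∈ₗ subsets n
∈-subsets Vec.[] = here refl
∈-subsets (outside Vec.∷ B) = ∈-++⁺ˡ (∈-map⁺ (outside Vec.∷_) (∈-subsets B))
∈-subsets {suc n} (inside Vec.∷ B) = ∈-++⁺ʳ (map (outside Vec.∷_) (subsets n))
    (∈-map⁺ (inside Vec.∷_) (∈-subsets B))

subsets-⊈ : ∀ n → AllPairs (λ B C → ¬ C ⊆ B) (subsets n)
subsets-⊈ zero = [] ∷ []
subsets-⊈ (suc n) = AllPairs.++⁺ (extend outside) (extend inside)
  -- Across the two halves, only the later subset contains the first element.
  (All.map⁺ (All.universal (λ B → All.map⁺ (All.universal (λ C C⊆B → case C⊆B Vec.here of λ ())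
    (subsets n))) (subsets n)))
  where
  extend : ∀ s → AllPairs (λ B C → ¬ C ⊆ B) (map (s Vec.∷_) (subsets n))
  extend s = AllPairs.map⁺ (AllPairs.map (λ {B} {C} → keep B C) (subsets-⊈ n))
    where
    keep : ∀ B C → ¬ C ⊆ B → ¬ s Vec.∷ C ⊆ s Vec.∷ B
    keep B C C⊈B C⊆B = C⊈B (drop-∷-⊆ C⊆B)

-- The sum of C(n,k) g(k) over `k`, written as Pascal's recursion to match the recursion of
-- `subsets`.
binomialSum : ℕ → (ℕ → ℤ) → ℤ
binomialSum zero g = g 0
binomialSum (suc n) g = binomialSum n g ℤ.+ binomialSum n (g ∘ suc)

sum-subsets : ∀ n (g : ℕ → ℕ) → ℤ.+ ListAction.sum (map (g ∘ ∣_∣) (subsets n)) ≡ binomialSum n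
    (ℤ.+_ ∘ g)
sum-subsets zero g = cong ℤ.+_ (ℕ.+-identityʳ (g 0))
sum-subsets (suc n) g = begin
  ℤ.+ ListAction.sum
      (map (g ∘ ∣_∣) (map (outside Vec.∷_) (subsets n) ++ map (inside Vec.∷_) (subsets n)))
    ≡⟨ cong (ℤ.+_ ∘ ListAction.sum)
        (trans (List.map-++ (g ∘ ∣_∣) (map (outside Vec.∷_) (subsets n)) _)
         (sym (cong₂ _++_ (List.map-∘ (subsets n)) (List.map-∘ (subsets n))))) ⟩
  ℤ.+ ListAction.sum (map (g ∘ ∣_∣) (subsets n) ++ map (g ∘ suc ∘ ∣_∣) (subsets n))
    ≡⟨ cong ℤ.+_ (sum-++ (map (g ∘ ∣_∣) (subsets n)) _) ⟩
  ℤ.+ ListAction.sum (map (g ∘ ∣_∣) (subsets n)) ℤ.+ ℤ.+ ListAction.sum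
      (map (g ∘ suc ∘ ∣_∣) (subsets n))
    ≡⟨ cong₂ ℤ._+_ (sum-subsets n g) (sum-subsets n (g ∘ suc)) ⟩
  binomialSum n (ℤ.+_ ∘ g) ℤ.+ binomialSum n (ℤ.+_ ∘ g ∘ suc) ∎
  where open ≡.≡-Reasoning

binomialSum-cong : ∀ n {f g} → (∀ k → f k ≡ g k) → binomialSum n f ≡ binomialSum n g
binomialSum-cong zero f≡g = f≡g 0
binomialSum-cong (suc n) f≡g = cong₂ ℤ._+_ (binomialSum-cong n f≡g) (binomialSum-cong n (f≡g ∘ suc))

binomialSum-+ : ∀ n f g → binomialSum n (λ k → f k ℤ.+ g k) ≡ binomialSum n f ℤ.+ binomialSum n g
binomialSum-+ zero f g = refl
binomialSum-+ (suc n) f g =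
    trans (cong₂ ℤ._+_ (binomialSum-+ n f g) (binomialSum-+ n (f ∘ suc) (g ∘ suc)))
  (lemma (binomialSum n f) (binomialSum n g) (binomialSum n (f ∘ suc)) (binomialSum n (g ∘ suc)))
  where
  lemma : ∀ a b c d → a ℤ.+ b ℤ.+ (c ℤ.+ d) ≡ a ℤ.+ c ℤ.+ (b ℤ.+ d)
  lemma = solve-∀

binomialSum-neg : ∀ n f → binomialSum n (λ k → ℤ.- f k) ≡ ℤ.- binomialSum n f
binomialSum-neg zero f = refl
binomialSum-neg (suc n) f = trans (cong₂ ℤ._+_ (binomialSum-neg n f) (binomialSum-neg n (f ∘ suc)))
  (sym (ℤ.neg-distrib-+ (binomialSum n f) _))

binomialSum-0 : ∀ n → binomialSum n (λ _ → 0ℤ) ≡ 0ℤ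
binomialSum-0 zero = refl
binomialSum-0 (suc n) = cong₂ ℤ._+_ (binomialSum-0 n) (binomialSum-0 n)

unitAt : ℕ → ℕ → ℤ
unitAt zero zero = 1ℤ
unitAt zero (suc k) = 0ℤ
unitAt (suc j) zero = 0ℤ
unitAt (suc j) (suc k) = unitAt j k

binomialSum-unitAt : ∀ n j → binomialSum n (unitAt j) ≡ ℤ.+ (n ℕ.C j)
binomialSum-unitAt zero zero = refl
binomialSum-unitAt zero (suc j) = refl
binomialSum-unitAt (suc n) zero = cong₂ ℤ._+_ (binomialSum-unitAt n zero) (binomialSum-0 n)
binomialSum-unitAt (suc n) (suc j) =
    trans (cong₂ ℤ._+_ (binomialSum-unitAt n (suc j)) (binomialSum-unitAt n j))
  (trans (ℤ.+-comm (ℤ.+ (n ℕ.C suc j)) (ℤ.+ (n ℕ.C j))) (cong ℤ.+_ (ℕ.nCk+nC[k+1]≡[n+1]C[k+1] n j)))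

quadratic : ℤ → ℤ → ℕ → ℤ
quadratic α β k = ℤ.+ k ℤ.* ℤ.+ k ℤ.+ β ℤ.* ℤ.+ k ℤ.+ α

-- Shifting `k` by one turns a monic quadratic into another one with new `α` and `β`, so the
-- induction keeps both general.
binomialSum-quadratic : ∀ m α β → let n = ℤ.+ (2 ℕ.+ m) in
  binomialSum (2 ℕ.+ m) (quadratic α β) ≡
  (ℤ.+ 4 ℤ.* α ℤ.+ ℤ.+ 2 ℤ.* β ℤ.* n ℤ.+ n ℤ.* (n ℤ.+ 1ℤ)) ℤ.* ℤ.+ (2 ^ m)
binomialSum-quadratic zero α β = lemma α β
  where
  lemma : ∀ α β →
    (0ℤ ℤ.+ β ℤ.* 0ℤ ℤ.+ α) ℤ.+ (1ℤ ℤ.+ β ℤ.* 1ℤ ℤ.+ α) ℤ.+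
    ((1ℤ ℤ.+ β ℤ.* 1ℤ ℤ.+ α) ℤ.+ (ℤ.+ 4 ℤ.+ β ℤ.* ℤ.+ 2 ℤ.+ α)) ≡
    (ℤ.+ 4 ℤ.* α ℤ.+ ℤ.+ 2 ℤ.* β ℤ.* ℤ.+ 2 ℤ.+ ℤ.+ 6) ℤ.* 1ℤ
  lemma = solve-∀
binomialSum-quadratic (suc m) α β = begin
  binomialSum (2 ℕ.+ m) (quadratic α β) ℤ.+ binomialSum (2 ℕ.+ m) (quadratic α β ∘ suc)
    ≡⟨ cong (λ x → binomialSum (2 ℕ.+ m) (quadratic α β) ℤ.+ x) (binomialSum-cong (2 ℕ.+ m) λ k →
        step α β (ℤ.+ k)) ⟩
  binomialSum (2 ℕ.+ m) (quadratic α β) ℤ.+ binomialSum (2 ℕ.+ m)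
      (quadratic (1ℤ ℤ.+ α ℤ.+ β) (ℤ.+ 2 ℤ.+ β))
    ≡⟨ cong₂ ℤ._+_ (binomialSum-quadratic m α β)
        (binomialSum-quadratic m (1ℤ ℤ.+ α ℤ.+ β) (ℤ.+ 2 ℤ.+ β)) ⟩
  _ ≡⟨ double α β (ℤ.+ (2 ℕ.+ m)) (ℤ.+ (2 ^ m)) ⟩
  (ℤ.+ 4 ℤ.* α ℤ.+ ℤ.+ 2 ℤ.* β ℤ.* N ℤ.+ N ℤ.* (N ℤ.+ 1ℤ)) ℤ.* (ℤ.+ 2 ℤ.* ℤ.+ (2 ^ m))
    ≡⟨ cong ((ℤ.+ 4 ℤ.* α ℤ.+ ℤ.+ 2 ℤ.* β ℤ.* N ℤ.+ N ℤ.* (N ℤ.+ 1ℤ)) ℤ.*_)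
        (sym (ℤ.pos-* 2 (2 ^ m))) ⟩
  (ℤ.+ 4 ℤ.* α ℤ.+ ℤ.+ 2 ℤ.* β ℤ.* N ℤ.+ N ℤ.* (N ℤ.+ 1ℤ)) ℤ.* ℤ.+ (2 ^ suc m) ∎
  where
  open ≡.≡-Reasoning
  N = 1ℤ ℤ.+ ℤ.+ (2 ℕ.+ m)
  step : ∀ α β k → (1ℤ ℤ.+ k) ℤ.* (1ℤ ℤ.+ k) ℤ.+ β ℤ.* (1ℤ ℤ.+ k) ℤ.+ α ≡
    k ℤ.* k ℤ.+ (ℤ.+ 2 ℤ.+ β) ℤ.* k ℤ.+ (1ℤ ℤ.+ α ℤ.+ β)
  step = solve-∀
  double : ∀ α β n p →
    (ℤ.+ 4 ℤ.* α ℤ.+ ℤ.+ 2 ℤ.* β ℤ.* n ℤ.+ n ℤ.* (n ℤ.+ 1ℤ)) ℤ.* p ℤ.+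
    (ℤ.+ 4 ℤ.* (1ℤ ℤ.+ α ℤ.+ β) ℤ.+ ℤ.+ 2 ℤ.* (ℤ.+ 2 ℤ.+ β) ℤ.* n ℤ.+ n ℤ.* (n ℤ.+ 1ℤ)) ℤ.* p ≡
    (ℤ.+ 4 ℤ.* α ℤ.+ ℤ.+ 2 ℤ.* β ℤ.* (1ℤ ℤ.+ n) ℤ.+ (1ℤ ℤ.+ n) ℤ.* ((1ℤ ℤ.+ n) ℤ.+ 1ℤ))
        ℤ.* (ℤ.+ 2 ℤ.* p)
  double = solve-∀

-- k (k − 2) is wrong at k = 1, 2, 3 by −1, −1 and 1: the source of the three
-- correction terms n, C(n,2) and −C(n,3).
layerSize-quadratic : ∀ k → ℤ.+ layerSize k ≡
  quadratic 0ℤ (ℤ.- ℤ.+ 2) k ℤ.+ unitAt 2 k ℤ.+ ℤ.- unitAt 3 k ℤ.+ unitAt 1 k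
layerSize-quadratic 0 = refl
layerSize-quadratic 1 = refl
layerSize-quadratic 2 = refl
layerSize-quadratic 3 = refl
layerSize-quadratic k@(suc (suc (suc (suc m)))) = trans (ℤ.pos-* k (2 ℕ.+ m)) (lemma (ℤ.+ m))
  where
  lemma : ∀ m → (ℤ.+ 4 ℤ.+ m) ℤ.* (ℤ.+ 2 ℤ.+ m) ≡
    (ℤ.+ 4 ℤ.+ m) ℤ.* (ℤ.+ 4 ℤ.+ m) ℤ.+ (ℤ.- ℤ.+ 2) ℤ.* (ℤ.+ 4 ℤ.+ m) ℤ.+ 0ℤ ℤ.+ 0ℤ ℤ.+ 0ℤ ℤ.+ 0ℤ
  lemma = solve-∀

sum-layerSize : ∀ m → let n = 2 ℕ.+ m in
  ℤ.+ ListAction.sum (map (layerSize ∘ ∣_∣) (subsets n)) ≡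
  ℤ.+ n ℤ.* (ℤ.+ n ℤ.- ℤ.+ 3) ℤ.* ℤ.+ (2 ^ m) ℤ.+ ℤ.+ (n ℕ.C 2) ℤ.- ℤ.+ (n ℕ.C 3) ℤ.+ ℤ.+ n
sum-layerSize m = begin
  ℤ.+ ListAction.sum (map (layerSize ∘ ∣_∣) (subsets N))
    ≡⟨ sum-subsets N layerSize ⟩
  binomialSum N (ℤ.+_ ∘ layerSize)
    ≡⟨ binomialSum-cong N layerSize-quadratic ⟩
  binomialSum N (λ k → q k ℤ.+ unitAt 2 k ℤ.+ ℤ.- unitAt 3 k ℤ.+ unitAt 1 k)
    ≡⟨ trans (binomialSum-+ N _ _) (cong (ℤ._+ binomialSum N (unitAt 1))
         (trans (binomialSum-+ N _ _)
             (cong₂ ℤ._+_ (binomialSum-+ N q (unitAt 2)) (binomialSum-neg N (unitAt 3))))) ⟩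
  binomialSum N q ℤ.+ binomialSum N (unitAt 2) ℤ.- binomialSum N (unitAt 3) ℤ.+ binomialSum N
      (unitAt 1)
    ≡⟨ cong₂ ℤ._+_ (cong₂ ℤ._-_ (cong₂ ℤ._+_
         (trans (binomialSum-quadratic m 0ℤ (ℤ.- ℤ.+ 2)) (cong (ℤ._* ℤ.+ (2 ^ m)) (factor (ℤ.+ N))))
         (binomialSum-unitAt N 2)) (binomialSum-unitAt N 3))
         (trans (binomialSum-unitAt N 1) (cong ℤ.+_ (ℕ.nC1≡n N))) ⟩
  ℤ.+ N ℤ.* (ℤ.+ N ℤ.- ℤ.+ 3) ℤ.* ℤ.+ (2 ^ m) ℤ.+ ℤ.+ (N ℕ.C 2) ℤ.- ℤ.+ (N ℕ.C 3) ℤ.+ ℤ.+ N ∎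
  where
  open ≡.≡-Reasoning
  N = 2 ℕ.+ m
  q = quadratic 0ℤ (ℤ.- ℤ.+ 2)
  factor : ∀ n → ℤ.+ 4 ℤ.* 0ℤ ℤ.+ ℤ.+ 2 ℤ.* (ℤ.- ℤ.+ 2) ℤ.* n ℤ.+ n ℤ.* (n ℤ.+ 1ℤ) ≡ n
      ℤ.* (n ℤ.- ℤ.+ 3)
  factor = solve-∀

-- The basis

distinct⇒2≤ : ∀ {k} {i j : Fin k} → i ≢ j → 2 ℕ.≤ k
distinct⇒2≤ {1} {0F} {0F} i≢j = contradiction refl i≢j
distinct⇒2≤ {suc (suc k)} _ = s≤s (s≤s z≤n)

matrixSpace : ∀ {n} (B : Subset n) → MatrixSpace (Realisation.k B)
matrixSpace B = record
  { Member = Realisable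
  ; m-cong = realisable-cong ; m-minus = realisable-minus ; m-+ = realisable-+ ; m-sgn =
      realisable-sgn
  ; m-I = typeI ; m-II = typeII ; m-0 = pair }
  where
  open Realisation B
  pair : ∀ c d → k ≡ 2 → Unique (c ∷ d ∷ []) →
      Realisable (λ i j → δ c i ℤ.* δ d j ℤ.- δ d i ℤ.* δ c j)
  pair c d k≡2 u with complement (c ∷ d ∷ []) u
  ... | [] , p = type0 c d p
  ... | _ ∷ _ , p with () ← trans (sym k≡2) (↭-length p)

module Assembly {c ℓ₁ ℓ₂ ℓ₃} (ℝ : Reals c ℓ₁ ℓ₂ ℓ₃) (n : ℕ) where

  open Real ℝ
  open Functionals ℝ {n}
  open Directions ℝ {n}
  open LinearAlgebra ℝ (Θ n)
  open Pivot
  open Layer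

  private
    Space = Point ℝ (Θ n)
    Direction = direction ℝ (Θ n) (aff ℝ (Θ n) (BW ℝ n))

  module _ (B : Subset n) where

    open Realisation B

    coordinate : Pivot (matrixSpace B) → Θ n
    coordinate p = record
      { a = ι (row p) ; b = ι (col p) ; B = B
      ; 2≤∣B∣ = subst (2 ℕ.≤_) (length-elems B) (distinct⇒2≤ (row≢col p))
      ; a∈B = ι-∈ B (row p) ; b∈B = ι-∈ B (col p) ; a≢b = row≢col p ∘ ι-injective }

    vector : Pivot (matrixSpace B) → Space
    vector p = real (u (member p))

    layerOf : Layer (matrixSpace B) ℓ₁
    layerOf = layer k (matrixSpace B)

    entry : Pivot (matrixSpace B) → Θ n × Space
    entry p = coordinate p , vector p

    block : List (Θ n × Space)
    block = map entry (pivots layerOf)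

    vector-at : ∀ p q {z} → matrix q (row p) (col p) ≡ z → vector q (coordinate p) ≡ fromℤ z
    vector-at p q eq = cong fromℤ (trans (agrees (member q) (row p) (col p)) eq)

    block-directions : All (Direction ∘ proj₂) block
    block-directions =
        All.map⁺ (All.universal (λ p → combination⇒direction (combination (member p)))
          (pivots layerOf))

    block-unital : Unital block
    block-unital =
        All.map⁺ (All.universal
          (λ p → ≈-trans (reflexive (vector-at p p (unit p))) (+-identityʳ 1#)) (pivots layerOf))

    block-triangular : Triangular block
    block-triangular =
        AllPairs.map⁺
          (AllPairs.map (λ {p} {q} p◁q → reflexive (vector-at p q p◁q)) (triangular layerOf))

    block-size : length block ≡ layerSize ∣ B ∣
    block-size = trans (List.length-map entry (pivots layerOf))
        (trans (size layerOf) (cong layerSize (length-elems B)))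

  -- Immediate from `vanishes`; with the order of `subsets` it makes the concatenated blocks
  -- triangular.
  blocks-triangular : ∀ {B C} → ¬ C ⊆ B → All (λ p → All (λ q → proj₂ q (proj₁ p) ≈ 0#) (block C))
      (block B)
  blocks-triangular {B} {C} C⊈B = All.map⁺ (All.universal (λ p → All.map⁺ (All.universal (λ q →
    reflexive (cong fromℤ (Realisation.vanishes (member q) _ _ B C⊈B))) (pivots (layerOf C))))
        (pivots (layerOf B)))

  basisList : List (Θ n × Space)
  basisList = concat (map block (subsets n))

  everywhere : ∀ {ℓ} {P : Θ n × Space → Set ℓ} → (∀ B → All P (block B)) → All P basisList
  everywhere all = All.concat⁺ (All.map⁺ (All.universal all (subsets n)))

  basis-triangular : Triangular basisList
  basis-triangular = AllPairs.concat⁺ (All.map⁺ (All.universal block-triangular (subsets n)))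
    (AllPairs.map⁺ (AllPairs.map blocks-triangular (subsets-⊈ n)))

  basis-size : length basisList ≡ ListAction.sum (map (layerSize ∘ ∣_∣) (subsets n))
  basis-size = sizes (subsets n)
    where
    sizes : ∀ Bs → length (concat (map block Bs)) ≡ ListAction.sum (map (layerSize ∘ ∣_∣) Bs)
    sizes [] = refl
    sizes (B ∷ Bs) = trans (List.length-++ (block B)) (cong₂ ℕ._+_ (block-size B) (sizes Bs))

  -- Induction along strict inclusion: once the blocks of all proper subsets are zero, the linear
  -- relations extend vanishing from the pivot coordinates to the whole block.
  separated : ∀ u → Extension 0# u → All (λ p → u (proj₁ p) ≈ 0#) basisList → ∀ θ → u θ ≈ 0#
  separated u X zs θ@(record { a = a ; b = b ; B = B ; a∈B = a∈B ; b∈B = b∈B ; a≢b = a≢b }) =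
    ≈-trans (≈-sym (E-vertex θ)) (allZero B (⊂-wellFounded B)
      -- The side conditions of `Θ` are irrelevant; decidability recovers usable proofs.
      (recompute (a ∈? B) a∈B) (recompute (b ∈? B) b∈B) (recompute (¬? (a ≟ b)) a≢b))
    where
    open Extension X
    open Annihilated X
    allZero : ∀ B → Acc _⊂_ B → Zero B
    allZero B (acc smaller) = zero-from-covered B (λ C⊂B → allZero _ (smaller C⊂B))
      (covered (layerOf B) (All.map⁻ (All.map (λ {p} z → ≈-trans (E-vertex (proj₁ p)) z)
        (All.lookup (All.concat⁻ zs) (∈-map⁺ block (∈-subsets B))))))

  hasDimension : HasDimension ℝ (Θ n) (BW ℝ n) (length basisList)
  hasDimension = (vertex ℝ Permutation.id , vertex∈aff Permutation.id) ,
    (λ j → proj₂ (lookup basisList j)) , record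
      { members = λ j → All.lookup directions (∈-lookup j)
      ; independent = independent basisList unital basis-triangular
      -- The elimination runs over `Extension 0#`, which holds of every direction and is directly
      -- seen to be closed under subtracting multiples.
      ; spanning = λ u u∈ → spanning (Extension 0#) closed basisList
          (All.map ext-direction directions)
          unital basis-triangular separated u (ext-direction u∈)
      }
    where
    directions = everywhere block-directions
    unital = everywhere block-unital
    closed : ∀ {u e} r → Extension 0# u → Extension 0# e → Extension 0# (λ θ → u θ - r * e θ)
    closed r X Y = ext-cong (+-zero ≈-refl (≈-trans (-‿cong (zeroʳ r)) -0#≈0#)) (λ _ → ≈-refl)
        (ext-minus r X Y)

open import Data.Integer.Base using (+_; _+_; _-_; _*_)
open import Data.Nat.Base using (ℕ; _≤_; _∸_; _^_)
open import Data.Nat.Combinatorics using (_C_)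
open import Data.Product.Base using (_×_; ∃-syntax)
open import Relation.Binary.PropositionalEquality.Core using (_≡_)

theorem1p1 : ∀ {c ℓ₁ ℓ₂ ℓ₃} (ℝ : Reals c ℓ₁ ℓ₂ ℓ₃) (n : ℕ) → 2 ≤ n →
    ∃[ d ] (HasDimension ℝ (Θ n) (BW ℝ n) d ×
    + d ≡ + n * (+ n - + 3) * + (2 ^ (n ∸ 2)) + + (n C 2) - + (n C 3) + + n)
theorem1p1 ℝ 1 (s≤s ())
-- With `n` of the form `2 + m`, the exponent `n ∸ 2` computes to `m`.
theorem1p1 ℝ n@(suc (suc m)) _ =
  length basisList , hasDimension , trans (cong +_ basis-size) (sum-layerSize m)
  where open Assembly ℝ n
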